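{- Let $u$ be a field ordinal and let $n \geq 1$ be an integer. Then the $n$-closure of $u$ in $\mathrm{On}_2$ (which is an $n$-closure of $u$) is an ordinal.
   Context: $\oplus$ and $\otimes$ denote Nim-sum and Nim-product of ordinals, defined recursively by $\alpha \oplus \beta = \operatorname{mex}\{\alpha' \oplus \beta, \alpha \oplus \beta' \mid \alpha'<\alpha, \beta'<\beta\}$ and $\alpha \otimes \beta = \operatorname{mex}\{(\alpha' \otimes \beta) \oplus (\alpha \otimes \beta') \oplus (\alpha' \otimes \beta') \mid \alpha'<\alpha, \beta'<\beta\}$, where $\operatorname{mex}(S)$ is the least ordinal not in $S$. With these operations the class of ordinals is a Field of characteristic 2, denoted $\mathrm{On}_2$. An ordinal $u$ is identified with the set of smaller ordinals; a field ordinal is an ordinal $u$ that is a subfield of $\mathrm{On}_2$. For an integer $n \geq 1$, a field $F$ is $n$-closed if every non-constant polynomial in $F[X]$ of degree at most $n$ has at least one root in $F$. For a field $K$ with algebraic closure $\overline{K}$, the $n$-closure of $K$ is $\overline{K}^n = \bigcap F$, the intersection over all $n$-closed fields $F$ with $K \subset F \subset \overline{K}$. The $n$-closure of $u$ in $\mathrm{On}_2$ is obtained by taking $\overline{u}$ to be the algebraic closure of $u$ in $\mathrm{On}_2$ (the set of all ordinals algebraic over $u$). -}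

module Defs where

open import Axiom.ExcludedMiddle using (ExcludedMiddle)
open import Data.Empty using (⊥; ⊥-elim)
open import Data.Maybe.Base using (Maybe; just; nothing)
open import Data.Nat.Base as ℕ using (ℕ)
open import Data.Product.Base using (Σ; ∃; _×_; _,_; proj₁; proj₂)
open import Data.Sum.Base using (_⊎_; inj₁; inj₂; [_,_])
open import Data.Unit.Base using (⊤; tt)
open import Data.Vec.Base using (Vec; last; foldr′)
open import Data.Vec.Relation.Unary.All using (All)
open import Induction.WellFounded using (Acc; acc; WellFounded)
open import Level using (Level; _⊔_; 0ℓ) renaming (suc to lsuc)
open import Relation.Binary.Definitions using (_Respects_)
open import Relation.Nullary using (¬_; yes; no)
open import Relation.Unary using (Pred; _∈_; _⊆_; _≐_)

------------------------------------------------------------------------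
-- Ordinals

-- `sup A f` is the least ordinal strictly greater than every `f a`.
-- Different trees may represent the same ordinal: equality of ordinals
-- is _≈_ below, not _≡_.  Assuming excluded middle, (Ord, _≈_, _<_) is
-- a well-ordered class in which every small family has a strict upper
-- bound, i.e. it is the class of all ordinals over Set.

data Ord : Set₁ where
  sup : (A : Set) → (A → Ord) → Ord

infix 4 _≤_ _<_ _≈_ _≉_

_≤_ : Ord → Ord → Set
sup A f ≤ sup B g = ∀ a → Σ B λ b → f a ≤ g b

_<_ : Ord → Ord → Set
α < sup B g = Σ B λ b → α ≤ g b

record _≈_ (α β : Ord) : Set where
  constructor antisym
  field
    ≈⇒≤ : α ≤ β
    ≈⇒≥ : β ≤ α

open _≈_ public

_≉_ : Ord → Ord → Set
α ≉ β = ¬ (α ≈ β)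

0# 1# : Ord
0# = sup ⊥ λ ()
1# = sup ⊤ λ _ → 0#

-- An ordinal seen as the set of smaller ordinals.

↓_ : Ord → Pred Ord 0ℓ
(↓ α) γ = γ < α

IsOrdinal : ∀ {ℓ} → Pred Ord ℓ → Set (lsuc 0ℓ ⊔ ℓ)
IsOrdinal P = ∃ λ α → P ≐ ↓ α

≤-refl : ∀ α → α ≤ α
≤-refl (sup A f) a = a , ≤-refl (f a)

≤-trans : ∀ {α β γ} → α ≤ β → β ≤ γ → α ≤ γ
≤-trans {sup _ _} {sup _ _} {sup _ _} p q a =
  let b , r = p a ; c , s = q b in c , ≤-trans r s

<-≤-trans : ∀ {α β γ} → α < β → β ≤ γ → α < γ
<-≤-trans {_} {sup _ _} {sup _ _} (b , r) q =
  let c , s = q b in c , ≤-trans r s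

≤-<-trans : ∀ {α β γ} → α ≤ β → β < γ → α < γ
≤-<-trans {γ = sup _ _} p (c , r) = c , ≤-trans p r

child< : ∀ {A} (f : A → Ord) a → f a < sup A f
child< f a = a , ≤-refl (f a)

<⇒≤ : ∀ {α β} → α < β → α ≤ β
<⇒≤ {sup _ f} {sup _ g} (b , r) a = b , <⇒≤ {f a} {g b} (<-≤-trans (child< f a) r)

≈-refl : ∀ {α} → α ≈ α
≈-refl {α} = antisym (≤-refl α) (≤-refl α)

≈-sym : ∀ {α β} → α ≈ β → β ≈ α
≈-sym (antisym p q) = antisym q p

≈-trans : ∀ {α β γ} → α ≈ β → β ≈ γ → α ≈ γ
≈-trans {α} {β} {γ} (antisym p q) (antisym r s) =
  antisym (≤-trans {α} {β} {γ} p r) (≤-trans {γ} {β} {α} s q)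

<-wellFounded : WellFounded _<_
<-wellFounded β = acc (go β)
  where
  go : ∀ β {α} → α < β → Acc _<_ α
  go (sup B g) (b , r) = acc λ p → go (g b) (<-≤-trans p r)

-- A small type enumerating the ordinals below α (all proper subtrees
-- of α; see below-complete).

Below : Ord → Set
Below (sup A f) = Σ A λ a → Maybe (Below (f a))

elem : ∀ α → Below α → Ord
elem (sup A f) (a , nothing) = f a
elem (sup A f) (a , just i)  = elem (f a) i

elem< : ∀ α i → elem α i < α
elem< (sup A f) (a , nothing) = child< f a
elem< (sup A f) (a , just i)  = a , <⇒≤ (elem< (f a) i)

-- The least element of a class of ordinals.

IsLeast : ∀ {ℓ} → Pred Ord ℓ → Ord → Set (lsuc 0ℓ ⊔ ℓ)
IsLeast P γ = γ ∈ P × (∀ δ → δ ∈ P → γ ≤ δ)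

IsMex : ∀ {ℓ} → Pred Ord ℓ → Ord → Set (lsuc 0ℓ ⊔ ℓ)
IsMex S = IsLeast λ γ → ¬ (γ ∈ S)

Range : {I : Set} → (I → Ord) → Pred Ord 0ℓ
Range f γ = ∃ λ i → γ ≈ f i

------------------------------------------------------------------------
-- Excluded middle is what makes mex, and hence Nim arithmetic, total.

module Nim (em : ∀ {ℓ} → ExcludedMiddle ℓ) where

  ≰⇒> : ∀ α β → ¬ (α ≤ β) → β < α
  ≮⇒≥ : ∀ α β → ¬ (α < β) → β ≤ α

  ≰⇒> (sup A f) (sup B g) ¬p with em {P = Σ A λ a → ¬ (f a < sup B g)}
  ... | yes (a , q) = a , ≮⇒≥ (f a) (sup B g) q
  ... | no ¬q = ⊥-elim (¬p λ a → lemma a)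
    where
    lemma : ∀ a → f a < sup B g
    lemma a with em {P = f a < sup B g}
    ... | yes r = r
    ... | no ¬r = ⊥-elim (¬q (a , ¬r))

  ≮⇒≥ (sup A f) (sup B g) ¬p b = ≰⇒> (sup A f) (g b) λ q → ¬p (b , q)

  below-complete : ∀ {γ} α → γ < α → ∃ λ i → γ ≈ elem α i
  below-complete {γ} (sup A f) (a , r) with em {P = f a ≤ γ}
  ... | yes s = (a , nothing) , antisym r s
  ... | no ¬s = let i , e = below-complete (f a) (≰⇒> (f a) γ ¬s) in (a , just i) , e

  least : ∀ {ℓ} (P : Pred Ord ℓ) → ∃ P → ∃ (IsLeast P)
  least P (α , Pα) = go α (<-wellFounded α) Pα
    where
    go : ∀ α → Acc _<_ α → P α → ∃ (IsLeast P)
    go α (acc rs) Pα with em {P = Σ Ord λ β → β < α × P β}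
    ... | yes (β , β<α , Pβ) = go β (rs β<α) Pβ
    ... | no ¬q = α , Pα , λ δ Pδ → ≮⇒≥ δ α λ δ<α → ¬q (δ , δ<α , Pδ)

  <-irrefl : ∀ {α} → ¬ (α < α)
  <-irrefl {α} = go (<-wellFounded α)
    where
    go : ∀ {α} → Acc _<_ α → ¬ (α < α)
    go (acc rs) p = go (rs p) p

  opaque
    mexΣ : {I : Set} (f : I → Ord) → ∃ (IsMex (Range f))
    mexΣ {I} f = least _ (sup I f , λ (i , e) → <-irrefl (≤-<-trans (≈⇒≤ e) (child< f i)))

  mex : {I : Set} → (I → Ord) → Ord
  mex f = proj₁ (mexΣ f)

  ----------------------------------------------------------------------
  -- Nim arithmetic

  infixl 6 _⊕_
  infixl 7 _⊗_

  ⊕-rec : ∀ α β → Acc _<_ α → Acc _<_ β → Ord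
  ⊕-rec α β (acc p) (acc q) = mex {Below α ⊎ Below β}
    [ (λ i → ⊕-rec (elem α i) β (p (elem< α i)) (acc q))
    , (λ j → ⊕-rec α (elem β j) (acc p) (q (elem< β j)))
    ]

  opaque
    _⊕_ : Ord → Ord → Ord
    α ⊕ β = ⊕-rec α β (<-wellFounded α) (<-wellFounded β)

  ⊗-rec : ∀ α β → Acc _<_ α → Acc _<_ β → Ord
  ⊗-rec α β (acc p) (acc q) = mex {Below α × Below β} λ (i , j) →
      ⊗-rec (elem α i) β (p (elem< α i)) (acc q)
    ⊕ ⊗-rec α (elem β j) (acc p) (q (elem< β j))
    ⊕ ⊗-rec (elem α i) (elem β j) (p (elem< α i)) (q (elem< β j))

  opaque
    _⊗_ : Ord → Ord → Ord
    α ⊗ β = ⊗-rec α β (<-wellFounded α) (<-wellFounded β)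

  -- The sets whose mex is taken in the recursive definitions of the
  -- Nim-sum and Nim-product; ⊕-isMex and ⊗-isMex confirm that the two
  -- operations satisfy these definitions verbatim.

  ⊕-options : Ord → Ord → Pred Ord (lsuc 0ℓ)
  ⊕-options α β γ = (∃ λ α′ → α′ < α × γ ≈ α′ ⊕ β)
                  ⊎ (∃ λ β′ → β′ < β × γ ≈ α ⊕ β′)

  ⊗-options : Ord → Ord → Pred Ord (lsuc 0ℓ)
  ⊗-options α β γ = ∃ λ α′ → ∃ λ β′ → α′ < α × β′ < β ×
    γ ≈ (α′ ⊗ β) ⊕ (α ⊗ β′) ⊕ (α′ ⊗ β′)

  least-⊆ : ∀ {ℓ ℓ′} {P : Pred Ord ℓ} {Q : Pred Ord ℓ′} {γ δ} →
            IsLeast P γ → IsLeast Q δ → Q ⊆ P → γ ≤ δ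
  least-⊆ (_ , l) (m , _) Q⊆P = l _ (Q⊆P m)

  mex-cong : {I J : Set} (f : I → Ord) (g : J → Ord) →
             (∀ i → ∃ λ j → f i ≈ g j) → (∀ j → ∃ λ i → g j ≈ f i) →
             mex f ≈ mex g
  mex-cong f g f⊆g g⊆f = antisym
    (least-⊆ (proj₂ (mexΣ f)) (proj₂ (mexΣ g)) (λ ¬g (i , e) → ¬g (incl f g f⊆g (i , e))))
    (least-⊆ (proj₂ (mexΣ g)) (proj₂ (mexΣ f)) (λ ¬f (j , e) → ¬f (incl g f g⊆f (j , e))))
    where
    incl : {I J : Set} (f : I → Ord) (g : J → Ord) →
           (∀ i → ∃ λ j → f i ≈ g j) → Range f ⊆ Range g
    incl f g h (i , e) = let j , e′ = h i in j , ≈-trans e e′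

  below-transport : ∀ {α α′} → α ≈ α′ → ∀ i → ∃ λ i′ → elem α i ≈ elem α′ i′
  below-transport {α} {α′} e i = below-complete α′ (<-≤-trans (elem< α i) (≈⇒≤ e))

  ⊕-rec-cong : ∀ {α α′ β β′} (a : Acc _<_ α) (a′ : Acc _<_ α′)
               (b : Acc _<_ β) (b′ : Acc _<_ β′) → α ≈ α′ → β ≈ β′ →
               ⊕-rec α β a b ≈ ⊕-rec α′ β′ a′ b′
  ⊕-rec-cong {α} {α′} {β} {β′} (acc p) (acc p′) (acc q) (acc q′) e h = mex-cong _ _
    (λ { (inj₁ i) → let i′ , e′ = below-transport e i in
           inj₁ i′ , ⊕-rec-cong (p (elem< α i)) (p′ (elem< α′ i′)) (acc q) (acc q′) e′ h
       ; (inj₂ j) → let j′ , h′ = below-transport h j in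
           inj₂ j′ , ⊕-rec-cong (acc p) (acc p′) (q (elem< β j)) (q′ (elem< β′ j′)) e h′ })
    (λ { (inj₁ i′) → let i , e′ = below-transport (≈-sym e) i′ in
           inj₁ i , ≈-sym (⊕-rec-cong (p (elem< α i)) (p′ (elem< α′ i′)) (acc q) (acc q′) (≈-sym e′) h)
       ; (inj₂ j′) → let j , h′ = below-transport (≈-sym h) j′ in
           inj₂ j , ≈-sym (⊕-rec-cong (acc p) (acc p′) (q (elem< β j)) (q′ (elem< β′ j′)) e (≈-sym h′)) })

  opaque
    unfolding _⊕_

    ⊕-cong : ∀ {α α′ β β′} → α ≈ α′ → β ≈ β′ → α ⊕ β ≈ α′ ⊕ β′
    ⊕-cong = ⊕-rec-cong (<-wellFounded _) (<-wellFounded _) (<-wellFounded _) (<-wellFounded _)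

  ⊗-rec-cong : ∀ {α α′ β β′} (a : Acc _<_ α) (a′ : Acc _<_ α′)
               (b : Acc _<_ β) (b′ : Acc _<_ β′) → α ≈ α′ → β ≈ β′ →
               ⊗-rec α β a b ≈ ⊗-rec α′ β′ a′ b′
  ⊗-rec-cong {α} {α′} {β} {β′} (acc p) (acc p′) (acc q) (acc q′) e h = mex-cong _ _
    (λ (i , j) → let i′ , e′ = below-transport e i ; j′ , h′ = below-transport h j in
       (i′ , j′) , ⊕-cong (⊕-cong
         (⊗-rec-cong (p (elem< α i)) (p′ (elem< α′ i′)) (acc q) (acc q′) e′ h)
         (⊗-rec-cong (acc p) (acc p′) (q (elem< β j)) (q′ (elem< β′ j′)) e h′))
         (⊗-rec-cong (p (elem< α i)) (p′ (elem< α′ i′)) (q (elem< β j)) (q′ (elem< β′ j′)) e′ h′))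
    (λ (i′ , j′) → let i , e′ = below-transport (≈-sym e) i′ ; j , h′ = below-transport (≈-sym h) j′ in
       (i , j) , ⊕-cong (⊕-cong
         (⊗-rec-cong (p′ (elem< α′ i′)) (p (elem< α i)) (acc q′) (acc q) e′ (≈-sym h))
         (⊗-rec-cong (acc p′) (acc p) (q′ (elem< β′ j′)) (q (elem< β j)) (≈-sym e) h′))
         (⊗-rec-cong (p′ (elem< α′ i′)) (p (elem< α i)) (q′ (elem< β′ j′)) (q (elem< β j)) e′ h′))

  opaque
    unfolding _⊗_

    ⊗-cong : ∀ {α α′ β β′} → α ≈ α′ → β ≈ β′ → α ⊗ β ≈ α′ ⊗ β′
    ⊗-cong = ⊗-rec-cong (<-wellFounded _) (<-wellFounded _) (<-wellFounded _) (<-wellFounded _)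

  least-resp : ∀ {ℓ ℓ′} {P : Pred Ord ℓ} {Q : Pred Ord ℓ′} → P ≐ Q → IsLeast P ⊆ IsLeast Q
  least-resp (P⊆Q , Q⊆P) (m , l) = P⊆Q m , λ δ Qδ → l δ (Q⊆P Qδ)

  mex-resp : ∀ {ℓ ℓ′} {S : Pred Ord ℓ} {T : Pred Ord ℓ′} → S ≐ T → IsMex S ⊆ IsMex T
  mex-resp (S⊆T , T⊆S) = least-resp ((λ ¬s t → ¬s (T⊆S t)) , (λ ¬t s → ¬t (S⊆T s)))

  opaque
    unfolding _⊕_

    ⊕-rec≈ : ∀ {α α′ β β′} (a : Acc _<_ α) (b : Acc _<_ β) → α ≈ α′ → β ≈ β′ →
             ⊕-rec α β a b ≈ α′ ⊕ β′
    ⊕-rec≈ a b = ⊕-rec-cong a (<-wellFounded _) b (<-wellFounded _)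

    ⊕-isMex : ∀ α β → IsMex (⊕-options α β) (α ⊕ β)
    ⊕-isMex α β = go (<-wellFounded α) (<-wellFounded β)
      where
      go : (a : Acc _<_ α) (b : Acc _<_ β) → IsMex (⊕-options α β) (⊕-rec α β a b)
      go (acc p) (acc q) = mex-resp
        ( (λ { (inj₁ i , e) → inj₁ (elem α i , elem< α i ,
                 ≈-trans e (⊕-rec≈ (p (elem< α i)) (acc q) ≈-refl ≈-refl))
             ; (inj₂ j , e) → inj₂ (elem β j , elem< β j ,
                 ≈-trans e (⊕-rec≈ (acc p) (q (elem< β j)) ≈-refl ≈-refl)) })
        , (λ { (inj₁ (_ , l , e)) → let i , e′ = below-complete α l in
                 inj₁ i , ≈-trans e (≈-sym (⊕-rec≈ (p (elem< α i)) (acc q) (≈-sym e′) ≈-refl))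
             ; (inj₂ (_ , l , e)) → let j , e′ = below-complete β l in
                 inj₂ j , ≈-trans e (≈-sym (⊕-rec≈ (acc p) (q (elem< β j)) ≈-refl (≈-sym e′))) }))
        (proj₂ (mexΣ _))

  opaque
    unfolding _⊗_

    ⊗-rec≈ : ∀ {α α′ β β′} (a : Acc _<_ α) (b : Acc _<_ β) → α ≈ α′ → β ≈ β′ →
             ⊗-rec α β a b ≈ α′ ⊗ β′
    ⊗-rec≈ a b = ⊗-rec-cong a (<-wellFounded _) b (<-wellFounded _)

    ⊗-isMex : ∀ α β → IsMex (⊗-options α β) (α ⊗ β)
    ⊗-isMex α β = go (<-wellFounded α) (<-wellFounded β)
      where
      go : (a : Acc _<_ α) (b : Acc _<_ β) → IsMex (⊗-options α β) (⊗-rec α β a b)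
      go (acc p) (acc q) = mex-resp
        ( (λ ((i , j) , e) → elem α i , elem β j , elem< α i , elem< β j ,
             ≈-trans e (option i j ≈-refl ≈-refl))
        , (λ (_ , _ , l , m , e) →
             let i , e′ = below-complete α l ; j , h′ = below-complete β m in
             (i , j) , ≈-trans e (≈-sym (option i j (≈-sym e′) (≈-sym h′)))))
        (proj₂ (mexΣ _))
        where
        option : ∀ {α′ β′} i j → elem α i ≈ α′ → elem β j ≈ β′ →
            ⊗-rec (elem α i) β (p (elem< α i)) (acc q)
          ⊕ ⊗-rec α (elem β j) (acc p) (q (elem< β j))
          ⊕ ⊗-rec (elem α i) (elem β j) (p (elem< α i)) (q (elem< β j))
          ≈ (α′ ⊗ β) ⊕ (α ⊗ β′) ⊕ (α′ ⊗ β′)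
        option i j e h = ⊕-cong (⊕-cong
          (⊗-rec≈ (p (elem< α i)) (acc q) e ≈-refl)
          (⊗-rec≈ (acc p) (q (elem< β j)) ≈-refl h))
          (⊗-rec≈ (p (elem< α i)) (q (elem< β j)) e h)

  ----------------------------------------------------------------------
  -- Subfields of On₂

  record IsSubfield {ℓ} (F : Pred Ord ℓ) : Set (lsuc 0ℓ ⊔ ℓ) where
    field
      respects  : F Respects _≈_
      0∈        : 0# ∈ F
      1∈        : 1# ∈ F
      ⊕-closed  : ∀ {α β} → α ∈ F → β ∈ F → α ⊕ β ∈ F
      ⊗-closed  : ∀ {α β} → α ∈ F → β ∈ F → α ⊗ β ∈ F
      negatives : ∀ {α} → α ∈ F → ∃ λ β → β ∈ F × α ⊕ β ≈ 0#
      inverses  : ∀ {α} → α ∈ F → α ≉ 0# → ∃ λ β → β ∈ F × α ⊗ β ≈ 1#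

  IsFieldOrdinal : Ord → Set₁
  IsFieldOrdinal u = IsSubfield (↓ u)

  -- Polynomials of degree exactly d over F, constant coefficient first.

  record Polynomial {ℓ} (F : Pred Ord ℓ) (d : ℕ) : Set (lsuc 0ℓ ⊔ ℓ) where
    field
      coeffs    : Vec Ord (ℕ.suc d)
      coeffs∈   : All F coeffs
      leading≉0 : last coeffs ≉ 0#

  eval : ∀ {m} → Vec Ord m → Ord → Ord
  eval cs x = foldr′ (λ c r → c ⊕ x ⊗ r) 0# cs

  IsRoot : ∀ {ℓ} {F : Pred Ord ℓ} {d} → Polynomial F d → Pred Ord 0ℓ
  IsRoot p x = eval (Polynomial.coeffs p) x ≈ 0#

  AlgebraicOver : ∀ {ℓ} → Pred Ord ℓ → Pred Ord (lsuc 0ℓ ⊔ ℓ)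
  AlgebraicOver K x = ∃ λ d → Σ (Polynomial K d) λ p → IsRoot p x

  IsNClosed : ∀ {ℓ} → ℕ → Pred Ord ℓ → Set (lsuc 0ℓ ⊔ ℓ)
  IsNClosed n F = ∀ d → 1 ℕ.≤ d → d ℕ.≤ n → (p : Polynomial F d) →
                  ∃ λ x → x ∈ F × IsRoot p x

  record IsAlgebraicClosure {k ℓ} (K : Pred Ord k) (L : Pred Ord ℓ)
         : Set (lsuc 0ℓ ⊔ k ⊔ ℓ) where
    field
      isSubfield          : IsSubfield L
      extends             : K ⊆ L
      algebraic           : L ⊆ AlgebraicOver K
      algebraicallyClosed : ∀ d → 1 ℕ.≤ d → (p : Polynomial L d) →
                            ∃ λ x → x ∈ L × IsRoot p x

  -- The intersection of all n-closed fields F with K ⊆ F ⊆ L.  Letting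
  -- F range over Set-valued predicates is no restriction: by excluded
  -- middle every predicate is equivalent to a Set-valued one.

  nClosureWithin : ∀ {k ℓ} → ℕ → Pred Ord k → Pred Ord ℓ → Pred Ord (lsuc 0ℓ ⊔ k ⊔ ℓ)
  nClosureWithin n K L x = (F : Pred Ord 0ℓ) → IsSubfield F → IsNClosed n F →
                           K ⊆ F → F ⊆ L → x ∈ F

  IsNClosure : ∀ {k ℓ} → ℕ → Pred Ord k → Pred Ord ℓ → Set (lsuc (lsuc 0ℓ) ⊔ k ⊔ ℓ)
  IsNClosure n K C = Σ (Pred Ord (lsuc 0ℓ)) λ L →
                     IsAlgebraicClosure K L × C ≐ nClosureWithin n K L

  -- The n-closure of u in On₂, taken inside the set of all ordinals
  -- algebraic over u.

  nClosure : ℕ → Ord → Pred Ord (lsuc 0ℓ)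
  nClosure n u = nClosureWithin n (↓ u) (AlgebraicOver (↓ u))

{-# OPTIONS --safe #-}

-- Call Δ n-transcendental if it is neither a sum nor a product of smaller
-- ordinals, nor a root of a polynomial of degree 1, …, n over them.  Then
-- Δ is an n-closed field: a polynomial c + X q of such a degree has
-- c < Δ ⊗ q(Δ), so c is an ordinal excluded by the mex defining Δ ⊗ q(Δ),
-- which yields δ < Δ and π with c + Δ q(Δ) = (Δ + δ) π.  Since the values
-- at Δ of the polynomials of bounded length form an initial segment, π is
-- the value of a polynomial too, and δ is a root.
--
-- The least ordinal outside a ring that contains all roots of degree at
-- most n over itself is n-transcendental.  For the ring of algebraic
-- ordinals over u, with every n, this makes the algebraic closure of u an
-- ordinal, which is bounded because each polynomial has finitely many
-- roots; for the n-closure C of u, the least w outside C is an n-closed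
-- field contained in C, so C = w.

module Submission where

open import Algebra.Bundles using (CommutativeMonoid; CommutativeSemiring; RawRing)
import Algebra.Solver.CommutativeMonoid as CommutativeMonoidSolver
import Algebra.Solver.Ring as RingSolver
open import Algebra.Solver.Ring.AlmostCommutativeRing
  using (AlmostCommutativeRing; fromCommutativeSemiring; Induced-equivalence; _-Raw-AlmostCommutative⟶_)
open import Axiom.ExcludedMiddle using (ExcludedMiddle)
open import Data.Bool.Base using (Bool; true; false; _∧_; _xor_)
open import Data.Empty using (⊥-elim)
open import Data.Maybe.Base using (just; nothing)
open import Data.Nat.Base as ℕ using (ℕ; zero; suc; z≤n; s≤s)
import Data.Nat.Properties as ℕₚ
open import Data.Product.Base using (Σ; ∃; _×_; _,_; proj₁; proj₂)
open import Data.Sum.Base using (_⊎_; inj₁; inj₂; [_,_])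
open import Data.Vec.Base using (Vec; []; _∷_; last; map; zipWith; _++_)
open import Data.Vec.Relation.Binary.Pointwise.Inductive as Pointwise using (Pointwise; []; _∷_)
open import Data.Vec.Relation.Unary.All as All using (All; []; _∷_)
open import Data.Vec.Relation.Unary.All.Properties using (map⁺; ++⁺)
open import Function.Base using (id; _∘_)
open import Induction.WellFounded using (Acc; acc)
open import Level using (Lift; lift; 0ℓ; _⊔_) renaming (suc to lsuc)
open import Relation.Binary.Bundles using (Setoid)
open import Relation.Binary.Definitions using (_Respects_; WeaklyDecidable)
open import Relation.Binary.PropositionalEquality.Core using (_≡_)
open import Relation.Nullary using (¬_; yes; no)
open import Relation.Nullary.Decidable using (decidable-stable)
open import Relation.Unary using (Pred; _∈_; _⊆_)

open import Defs

module _ (em : ∀ {ℓ} → ExcludedMiddle ℓ) where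
  open Nim em

  -- Comparison of ordinals and properties of mex

  ordSetoid : Setoid (lsuc 0ℓ) 0ℓ
  ordSetoid = record
    { Carrier = Ord
    ; _≈_ = _≈_
    ; isEquivalence = record { refl = ≈-refl ; sym = ≈-sym ; trans = ≈-trans }
    }

  open import Relation.Binary.Reasoning.Setoid ordSetoid

  <⇒≉ : ∀ α β → α < β → α ≉ β
  <⇒≉ α β α<β α≈β = <-irrefl {α} (<-≤-trans {α} {β} {α} α<β (≈⇒≥ α≈β))

  ≉⇒≶ : ∀ α β → α ≉ β → α < β ⊎ β < α
  ≉⇒≶ α β α≉β with em {P = α ≤ β}
  ... | no ¬p = inj₂ (≰⇒> α β ¬p)
  ... | yes p with em {P = β ≤ α}
  ...   | no ¬q = inj₁ (≰⇒> β α ¬q)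
  ...   | yes q = ⊥-elim (α≉β (antisym p q))

  <-trans : ∀ γ {β α} → β < γ → α < β → α < γ
  <-trans γ {β} {α} β<γ α<β = <-≤-trans {α} {β} {γ} α<β (<⇒≤ {β} {γ} β<γ)

  <-respˡ : ∀ α {β γ} → β ≈ γ → β < α → γ < α
  <-respˡ α {β} {γ} β≈γ = ≤-<-trans {γ} {β} {α} (≈⇒≥ β≈γ)

  0≤ : ∀ α → 0# ≤ α
  0≤ (sup _ _) ()

  ≮0 : ∀ α → ¬ (α < 0#)
  ≮0 _ ()

  ≉0⇒> : ∀ α → α ≉ 0# → 0# < α
  ≉0⇒> α α≉0 with ≉⇒≶ 0# α (α≉0 ∘ ≈-sym)
  ... | inj₁ 0<α = 0<α

  mex-∋ : ∀ {ℓ} {S : Pred Ord ℓ} γ {δ} → IsMex S γ → δ < γ → S δ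
  mex-∋ γ {δ} (_ , l) δ<γ = decidable-stable em λ δ∉S →
    <-irrefl {δ} (<-≤-trans {δ} {γ} {δ} δ<γ (l δ δ∉S))

  -- Each value avoids the other set, so minimality bounds each by the other. Identities between Nim
  -- expressions thereby reduce to showing that neither side is an option of the other.
  mex-≈ : ∀ {ℓ ℓ′} {S : Pred Ord ℓ} {T : Pred Ord ℓ′} {γ δ} →
          IsMex S γ → IsMex T δ → ¬ S δ → ¬ T γ → γ ≈ δ
  mex-≈ (_ , l) (_ , m) δ∉S γ∉T = antisym (l _ δ∉S) (m _ γ∉T)

  -- The Nim-sum

  -- If `α` and `α′` differ, one is smaller, and its sum with `β` is an option of the other sum,
  -- which the mex avoids.
  ⊕-cancelʳ : ∀ {α α′} β → α ⊕ β ≈ α′ ⊕ β → α ≈ α′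
  ⊕-cancelʳ {α} {α′} β e = decidable-stable em λ α≉α′ →
    [ (λ l → proj₁ (⊕-isMex α′ β) (inj₁ (α , l , ≈-sym e)))
    , (λ l → proj₁ (⊕-isMex α β) (inj₁ (α′ , l , e))) ] (≉⇒≶ α α′ α≉α′)

  ⊕-cancelˡ : ∀ α {β β′} → α ⊕ β ≈ α ⊕ β′ → β ≈ β′
  ⊕-cancelˡ α {β} {β′} e = decidable-stable em λ β≉β′ →
    [ (λ l → proj₁ (⊕-isMex α β′) (inj₂ (β , l , ≈-sym e)))
    , (λ l → proj₁ (⊕-isMex α β) (inj₂ (β′ , l , e))) ] (≉⇒≶ β β′ β≉β′)

  ⊕-comm : ∀ α β → α ⊕ β ≈ β ⊕ α
  ⊕-comm α β = go (<-wellFounded α) (<-wellFounded β)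
    where
    go : ∀ {α β} → Acc _<_ α → Acc _<_ β → α ⊕ β ≈ β ⊕ α
    go {α} {β} a@(acc p) b@(acc q) = mex-≈ (⊕-isMex α β) (⊕-isMex β α)
      (λ { (inj₁ (α′ , l , e)) → <⇒≉ α′ α l (⊕-cancelˡ β (≈-sym (≈-trans e (go (p l) b))))
         ; (inj₂ (β′ , l , e)) → <⇒≉ β′ β l (⊕-cancelʳ α (≈-sym (≈-trans e (go a (q l))))) })
      (λ { (inj₁ (β′ , l , e)) → <⇒≉ β′ β l (⊕-cancelˡ α (≈-trans (go a (q l)) (≈-sym e)))
         ; (inj₂ (α′ , l , e)) → <⇒≉ α′ α l (⊕-cancelʳ β (≈-trans (go (p l) b) (≈-sym e))) })

  -- Every option lowers one of the three summands; the induction hypothesis reassociates the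
  -- lowered sum, and cancellation then equates an ordinal with a smaller one.
  ⊕-assoc : ∀ α β γ → (α ⊕ β) ⊕ γ ≈ α ⊕ (β ⊕ γ)
  ⊕-assoc α β γ = go (<-wellFounded α) (<-wellFounded β) (<-wellFounded γ)
    where
    go : ∀ {α β γ} → Acc _<_ α → Acc _<_ β → Acc _<_ γ → (α ⊕ β) ⊕ γ ≈ α ⊕ (β ⊕ γ)
    go {α} {β} {γ} a@(acc p) b@(acc q) c@(acc r) =
      mex-≈ (⊕-isMex (α ⊕ β) γ) (⊕-isMex α (β ⊕ γ)) left right
      where
      moveα : ∀ {α′} → α′ < α → (α′ ⊕ β) ⊕ γ ≉ α ⊕ (β ⊕ γ)
      moveα {α′} l e = <⇒≉ α′ α l (⊕-cancelʳ (β ⊕ γ) (≈-trans (≈-sym (go (p l) b c)) e))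
      moveβ : ∀ {β′} → β′ < β → (α ⊕ β′) ⊕ γ ≉ α ⊕ (β ⊕ γ)
      moveβ {β′} l e = <⇒≉ β′ β l
        (⊕-cancelʳ γ (⊕-cancelˡ α (≈-trans (≈-sym (go a (q l) c)) e)))
      moveγ : ∀ {γ′} → γ′ < γ → (α ⊕ β) ⊕ γ′ ≉ α ⊕ (β ⊕ γ)
      moveγ {γ′} l e = <⇒≉ γ′ γ l
        (⊕-cancelˡ β (⊕-cancelˡ α (≈-trans (≈-sym (go a b (r l))) e)))
      moveα′ : ∀ {α′} → α′ < α → α′ ⊕ (β ⊕ γ) ≉ (α ⊕ β) ⊕ γ
      moveα′ {α′} l e = <⇒≉ α′ α l
        (⊕-cancelʳ β (⊕-cancelʳ γ (≈-trans (go (p l) b c) e)))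
      moveβ′ : ∀ {β′} → β′ < β → α ⊕ (β′ ⊕ γ) ≉ (α ⊕ β) ⊕ γ
      moveβ′ {β′} l e = <⇒≉ β′ β l
        (⊕-cancelˡ α (⊕-cancelʳ γ (≈-trans (go a (q l) c) e)))
      moveγ′ : ∀ {γ′} → γ′ < γ → α ⊕ (β ⊕ γ′) ≉ (α ⊕ β) ⊕ γ
      moveγ′ {γ′} l e = <⇒≉ γ′ γ l (⊕-cancelˡ (α ⊕ β) (≈-trans (go a b (r l)) e))

      left : ¬ ⊕-options (α ⊕ β) γ (α ⊕ (β ⊕ γ))
      -- Any ordinal below a mex is an option, so `η` arises by lowering `α` or `β`.
      left (inj₁ (η , l , e)) with mex-∋ (α ⊕ β) (⊕-isMex α β) l
      ... | inj₁ (α′ , l′ , e′) = moveα l′ (≈-sym (≈-trans e (⊕-cong e′ ≈-refl)))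
      ... | inj₂ (β′ , l′ , e′) = moveβ l′ (≈-sym (≈-trans e (⊕-cong e′ ≈-refl)))
      left (inj₂ (γ′ , l , e)) = moveγ l (≈-sym e)

      right : ¬ ⊕-options α (β ⊕ γ) ((α ⊕ β) ⊕ γ)
      right (inj₁ (α′ , l , e)) = moveα′ l (≈-sym e)
      right (inj₂ (η , l , e)) with mex-∋ (β ⊕ γ) (⊕-isMex β γ) l
      ... | inj₁ (β′ , l′ , e′) = moveβ′ l′ (≈-sym (≈-trans e (⊕-cong ≈-refl e′)))
      ... | inj₂ (γ′ , l′ , e′) = moveγ′ l′ (≈-sym (≈-trans e (⊕-cong ≈-refl e′)))

  ⊕-identityˡ : ∀ α → 0# ⊕ α ≈ α
  ⊕-identityˡ α = go (<-wellFounded α)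
    where
    go : ∀ {α} → Acc _<_ α → 0# ⊕ α ≈ α
    go {α} (acc p) = antisym
      (proj₂ (⊕-isMex 0# α) α λ
        { (inj₁ (_ , () , _))
        ; (inj₂ (α′ , l , e)) → <⇒≉ α′ α l (≈-sym (≈-trans e (go (p l)))) })
      -- Were `0# ⊕ α` below `α`, the induction hypothesis would give `0# ⊕ (0# ⊕ α) ≈ 0# ⊕ α`, and
      -- cancelling `0#` would make the two equal.
      (≮⇒≥ (0# ⊕ α) α λ l → <⇒≉ (0# ⊕ α) α l (⊕-cancelˡ 0# (go (p l))))

  ⊕-self : ∀ α → α ⊕ α ≈ 0#
  ⊕-self α = go (<-wellFounded α)
    where
    go : ∀ {α} → Acc _<_ α → α ⊕ α ≈ 0#
    go {α} (acc p) = antisym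
      (proj₂ (⊕-isMex α α) 0# λ
        { (inj₁ (α′ , l , e)) → <⇒≉ α′ α l (⊕-cancelˡ α′ (≈-trans (go (p l)) e))
        ; (inj₂ (α′ , l , e)) → <⇒≉ α′ α l (⊕-cancelʳ α′ (≈-trans (go (p l)) e)) })
      (0≤ (α ⊕ α))

  ⊕-identityʳ : ∀ α → α ⊕ 0# ≈ α
  ⊕-identityʳ α = ≈-trans (⊕-comm α 0#) (⊕-identityˡ α)

  ⊕-commutativeMonoid : CommutativeMonoid (lsuc 0ℓ) 0ℓ
  ⊕-commutativeMonoid = record
    { Carrier = Ord
    ; _≈_ = _≈_
    ; _∙_ = _⊕_
    ; ε = 0#
    ; isCommutativeMonoid = record
      { isMonoid = record
        { isSemigroup = record
          { isMagma = record
            { isEquivalence = Setoid.isEquivalence ordSetoid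
            ; ∙-cong = ⊕-cong
            }
          ; assoc = ⊕-assoc
          }
        ; identity = ⊕-identityˡ , ⊕-identityʳ
        }
      ; comm = ⊕-comm
      }
    }

  open CommutativeMonoidSolver ⊕-commutativeMonoid using (_⊜_)
    renaming (solve to ⊕-solve; _⊕_ to _⊞_)

  ⊕≈0⇒≈ : ∀ {α β} → α ⊕ β ≈ 0# → α ≈ β
  ⊕≈0⇒≈ {α} {β} e = ⊕-cancelʳ β (≈-trans e (≈-sym (⊕-self β)))

  -- The Nim-product

  ⊗-option≉ : ∀ {α α′ β β′} → α′ < α → β′ < β →
              α ⊗ β ≉ (α′ ⊗ β) ⊕ (α ⊗ β′) ⊕ (α′ ⊗ β′)
  ⊗-option≉ {α} {α′} {β} {β′} l m e = proj₁ (⊗-isMex α β) (α′ , β′ , l , m , e)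

  ⊗-∋ : ∀ {α β η} → η < α ⊗ β → ⊗-options α β η
  ⊗-∋ {α} {β} = mex-∋ (α ⊗ β) (⊗-isMex α β)

  ⊗-zeroʳ : ∀ α → α ⊗ 0# ≈ 0#
  ⊗-zeroʳ α = antisym
    (proj₂ (⊗-isMex α 0#) 0# λ { (_ , _ , _ , () , _) })
    (0≤ (α ⊗ 0#))

  ⊗-comm : ∀ α β → α ⊗ β ≈ β ⊗ α
  ⊗-comm α β = go (<-wellFounded α) (<-wellFounded β)
    where
    swap : ∀ {x y z} → (x ⊕ y) ⊕ z ≈ (y ⊕ x) ⊕ z
    swap {x} {y} = ⊕-cong (⊕-comm x y) ≈-refl

    go : ∀ {α β} → Acc _<_ α → Acc _<_ β → α ⊗ β ≈ β ⊗ α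
    go {α} {β} a@(acc p) b@(acc q) = mex-≈ (⊗-isMex α β) (⊗-isMex β α)
      (λ (_ , _ , l , m , e) → ⊗-option≉ m l (≈-trans e (≈-trans
         (⊕-cong (⊕-cong (go (p l) b) (go a (q m))) (go (p l) (q m))) swap)))
      (λ (_ , _ , m , l , e) → ⊗-option≉ l m (≈-trans e (≈-trans swap
         (≈-sym (⊕-cong (⊕-cong (go (p l) b) (go a (q m))) (go (p l) (q m)))))))

  ⊗-zeroˡ : ∀ α → 0# ⊗ α ≈ 0#
  ⊗-zeroˡ α = ≈-trans (⊗-comm 0# α) (⊗-zeroʳ α)

  ⊗-option-0 : ∀ α α′ β → (α′ ⊗ β) ⊕ (α ⊗ 0#) ⊕ (α′ ⊗ 0#) ≈ α′ ⊗ β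
  ⊗-option-0 α α′ β = begin
    (α′ ⊗ β) ⊕ (α ⊗ 0#) ⊕ (α′ ⊗ 0#)  ≈⟨ ⊕-cong (⊕-cong ≈-refl (⊗-zeroʳ α)) (⊗-zeroʳ α′) ⟩
    (α′ ⊗ β) ⊕ 0# ⊕ 0#               ≈⟨ ⊕-identityʳ _ ⟩
    (α′ ⊗ β) ⊕ 0#                    ≈⟨ ⊕-identityʳ _ ⟩
    α′ ⊗ β                           ∎

  -- The option that lowers both factors to `0#` is itself `0#`, so the mex is not.
  ⊗-nonzero : ∀ {α β} → α ≉ 0# → β ≉ 0# → α ⊗ β ≉ 0#
  ⊗-nonzero {α} {β} α≉0 β≉0 e = ⊗-option≉ (≉0⇒> α α≉0) (≉0⇒> β β≉0)
    (≈-trans e (≈-sym (≈-trans (⊗-option-0 α 0# β) (⊗-zeroˡ β))))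

  ⊗-identityʳ : ∀ α → α ⊗ 1# ≈ α
  ⊗-identityʳ α = go (<-wellFounded α)
    where
    go : ∀ {α} → Acc _<_ α → α ⊗ 1# ≈ α
    go {α} (acc p) = antisym
      (proj₂ (⊗-isMex α 1#) α λ (α′ , β′ , l , (_ , m) , e) →
        <⇒≉ α′ α l (≈-sym (begin
          α                                    ≈⟨ e ⟩
          (α′ ⊗ 1#) ⊕ (α ⊗ β′) ⊕ (α′ ⊗ β′)     ≈⟨ ⊕-cong (⊕-cong ≈-refl
                                                    (⊗-cong (≈-refl {α}) (β′≈0 m)))
                                                    (⊗-cong (≈-refl {α′}) (β′≈0 m)) ⟩
          (α′ ⊗ 1#) ⊕ (α ⊗ 0#) ⊕ (α′ ⊗ 0#)     ≈⟨ ⊗-option-0 α α′ 1# ⟩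
          α′ ⊗ 1#                              ≈⟨ go (p l) ⟩
          α′                                   ∎)))
      -- Were `α ⊗ 1#` below `α`, it would by induction equal `(α ⊗ 1#) ⊗ 1#`, which is an option of
      -- `α ⊗ 1#`.
      (≮⇒≥ (α ⊗ 1#) α λ l → ⊗-option≉ l (child< _ _)
        (≈-trans (≈-sym (go (p l))) (≈-sym (⊗-option-0 α (α ⊗ 1#) 1#))))
      where
      β′≈0 : ∀ {β′} → β′ ≤ 0# → β′ ≈ 0#
      β′≈0 {β′} m = antisym m (0≤ β′)

  -- Unlike ⊗-option≉, this makes no assumption on the order of α and α′,
  -- nor of β and β′: the expression is symmetric under both swaps.
  cross≉0 : ∀ {α α′ β β′} → α ≉ α′ → β ≉ β′ →
            (α ⊗ β ⊕ α′ ⊗ β) ⊕ (α ⊗ β′ ⊕ α′ ⊗ β′) ≉ 0#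
  cross≉0 {α} {α′} {β} {β′} α≉α′ β≉β′ e
    with ≉⇒≶ α α′ α≉α′ | ≉⇒≶ β β′ β≉β′
  ... | inj₂ l | inj₂ m = ⊗-option≉ l m (⊕≈0⇒≈ (≈-trans (⊕-solve 4
          (λ a b c d → a ⊞ ((b ⊞ c) ⊞ d) ⊜ (a ⊞ b) ⊞ (c ⊞ d)) ≈-refl _ _ _ _) e))
  ... | inj₁ l | inj₂ m = ⊗-option≉ l m (⊕≈0⇒≈ (≈-trans (⊕-solve 4
          (λ a b c d → b ⊞ ((a ⊞ d) ⊞ c) ⊜ (a ⊞ b) ⊞ (c ⊞ d)) ≈-refl _ _ _ _) e))
  ... | inj₂ l | inj₁ m = ⊗-option≉ l m (⊕≈0⇒≈ (≈-trans (⊕-solve 4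
          (λ a b c d → c ⊞ ((d ⊞ a) ⊞ b) ⊜ (a ⊞ b) ⊞ (c ⊞ d)) ≈-refl _ _ _ _) e))
  ... | inj₁ l | inj₁ m = ⊗-option≉ l m (⊕≈0⇒≈ (≈-trans (⊕-solve 4
          (λ a b c d → d ⊞ ((c ⊞ b) ⊞ a) ⊜ (a ⊞ b) ⊞ (c ⊞ d)) ≈-refl _ _ _ _) e))

  -- An option of the left side lowers, say, `α ⊕ β` to `α′ ⊕ β`; distributing by induction and
  -- cancelling `β ⊗ γ` makes `α ⊗ γ` one of its own options. Conversely, lowering `α ⊗ γ` brings in
  -- `α′` and `γ′`, and equality would contradict `cross≉0` for `α ⊕ β`, `α′ ⊕ β`, `γ`, `γ′`.
  ⊗-distribʳ : ∀ γ α β → (α ⊕ β) ⊗ γ ≈ α ⊗ γ ⊕ β ⊗ γ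
  ⊗-distribʳ γ α β = go (<-wellFounded α) (<-wellFounded β) (<-wellFounded γ)
    where
    -- D and E stand for β γ and β γ′, and A, B, C for the three terms of
    -- an option of α γ.
    merge : ∀ A B C D E → ((A ⊕ D) ⊕ (B ⊕ E)) ⊕ (C ⊕ E) ≈ ((A ⊕ B) ⊕ C) ⊕ D
    merge A B C D E = begin
      ((A ⊕ D) ⊕ (B ⊕ E)) ⊕ (C ⊕ E)    ≈⟨ ⊕-solve 5 (λ A B C D E →
                                            ((A ⊞ D) ⊞ (B ⊞ E)) ⊞ (C ⊞ E) ⊜
                                            (((A ⊞ B) ⊞ C) ⊞ D) ⊞ (E ⊞ E))
                                            ≈-refl A B C D E ⟩
      (((A ⊕ B) ⊕ C) ⊕ D) ⊕ (E ⊕ E)    ≈⟨ ⊕-cong ≈-refl (⊕-self E) ⟩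
      (((A ⊕ B) ⊕ C) ⊕ D) ⊕ 0#         ≈⟨ ⊕-identityʳ _ ⟩
      ((A ⊕ B) ⊕ C) ⊕ D                ∎

    cancel : ∀ A B C D E → ((((A ⊕ B) ⊕ C) ⊕ D) ⊕ (A ⊕ D)) ⊕ ((B ⊕ E) ⊕ (C ⊕ E)) ≈ 0#
    cancel A B C D E = ≈-trans
      (⊕-solve 5 (λ A B C D E →
        ((((A ⊞ B) ⊞ C) ⊞ D) ⊞ (A ⊞ D)) ⊞ ((B ⊞ E) ⊞ (C ⊞ E)) ⊜
        ((((A ⊞ B) ⊞ C) ⊞ D) ⊞ E) ⊞ ((((A ⊞ B) ⊞ C) ⊞ D) ⊞ E)) ≈-refl A B C D E)
      (⊕-self _)

    flip : ∀ {x y z} → x ≈ y ⊕ z → x ≈ z ⊕ y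
    flip {_} {y} {z} e = ≈-trans e (⊕-comm y z)

    go : ∀ {α β γ} → Acc _<_ α → Acc _<_ β → Acc _<_ γ → (α ⊕ β) ⊗ γ ≈ α ⊗ γ ⊕ β ⊗ γ
    go {α} {β} {γ} a@(acc p) b@(acc q) c@(acc r) =
      mex-≈ (⊗-isMex (α ⊕ β) γ) (⊕-isMex (α ⊗ γ) (β ⊗ γ)) left right
      where
      left : ¬ ⊗-options (α ⊕ β) γ (α ⊗ γ ⊕ β ⊗ γ)
      left (η , γ′ , l , m , e) with mex-∋ (α ⊕ β) (⊕-isMex α β) l
      ... | inj₁ (α′ , l′ , h) = ⊗-option≉ l′ m (⊕-cancelʳ (β ⊗ γ) (begin
        α ⊗ γ ⊕ β ⊗ γ
          ≈⟨ e ⟩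
        (η ⊗ γ) ⊕ ((α ⊕ β) ⊗ γ′) ⊕ (η ⊗ γ′)
          ≈⟨ ⊕-cong (⊕-cong
               (≈-trans (⊗-cong h ≈-refl) (go (p l′) b c))
               (go a b (r m)))
               (≈-trans (⊗-cong h ≈-refl) (go (p l′) b (r m))) ⟩
        ((α′ ⊗ γ ⊕ β ⊗ γ) ⊕ (α ⊗ γ′ ⊕ β ⊗ γ′)) ⊕ (α′ ⊗ γ′ ⊕ β ⊗ γ′)
          ≈⟨ merge _ _ _ _ _ ⟩
        (α′ ⊗ γ ⊕ α ⊗ γ′ ⊕ α′ ⊗ γ′) ⊕ β ⊗ γ
          ∎))
      ... | inj₂ (β′ , l′ , h) = ⊗-option≉ l′ m (⊕-cancelʳ (α ⊗ γ) (begin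
        β ⊗ γ ⊕ α ⊗ γ
          ≈⟨ ⊕-comm (β ⊗ γ) (α ⊗ γ) ⟩
        α ⊗ γ ⊕ β ⊗ γ
          ≈⟨ e ⟩
        (η ⊗ γ) ⊕ ((α ⊕ β) ⊗ γ′) ⊕ (η ⊗ γ′)
          ≈⟨ ⊕-cong (⊕-cong
               (≈-trans (⊗-cong h ≈-refl) (flip (go a (q l′) c)))
               (flip (go a b (r m))))
               (≈-trans (⊗-cong h ≈-refl) (flip (go a (q l′) (r m)))) ⟩
        ((β′ ⊗ γ ⊕ α ⊗ γ) ⊕ (β ⊗ γ′ ⊕ α ⊗ γ′)) ⊕ (β′ ⊗ γ′ ⊕ α ⊗ γ′)
          ≈⟨ merge _ _ _ _ _ ⟩
        (β′ ⊗ γ ⊕ β ⊗ γ′ ⊕ β′ ⊗ γ′) ⊕ α ⊗ γ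
          ∎))

      right : ¬ ⊕-options (α ⊗ γ) (β ⊗ γ) ((α ⊕ β) ⊗ γ)
      right (inj₁ (η , l , e)) with ⊗-∋ l
      ... | α′ , γ′ , l′ , m , h = cross≉0
        (<⇒≉ α′ α l′ ∘ ≈-sym ∘ ⊕-cancelʳ β) (<⇒≉ γ′ γ m ∘ ≈-sym)
        (≈-trans (⊕-cong
          (⊕-cong (≈-trans e (⊕-cong h ≈-refl)) (go (p l′) b c))
          (⊕-cong (go a b (r m)) (go (p l′) b (r m))))
          (cancel _ _ _ _ _))
      right (inj₂ (η , l , e)) with ⊗-∋ l
      ... | β′ , γ′ , l′ , m , h = cross≉0
        (<⇒≉ β′ β l′ ∘ ≈-sym ∘ ⊕-cancelˡ α) (<⇒≉ γ′ γ m ∘ ≈-sym)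
        (≈-trans (⊕-cong
          (⊕-cong (≈-trans e (≈-trans (⊕-cong ≈-refl h) (⊕-comm (α ⊗ γ) _)))
                  (flip (go a (q l′) c)))
          (⊕-cong (flip (go a b (r m))) (flip (go a (q l′) (r m)))))
          (cancel _ _ _ _ _))

  ⊗-distribˡ : ∀ γ α β → γ ⊗ (α ⊕ β) ≈ γ ⊗ α ⊕ γ ⊗ β
  ⊗-distribˡ γ α β = ≈-trans (⊗-comm γ (α ⊕ β))
    (≈-trans (⊗-distribʳ γ α β) (⊕-cong (⊗-comm α γ) (⊗-comm β γ)))

  ⊗-distrib : ∀ α α′ β β′ →
              (α ⊕ α′) ⊗ (β ⊕ β′) ≈ (α ⊗ β ⊕ α′ ⊗ β) ⊕ (α ⊗ β′ ⊕ α′ ⊗ β′)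
  ⊗-distrib α α′ β β′ = ≈-trans (⊗-distribˡ (α ⊕ α′) β β′)
    (⊕-cong (⊗-distribʳ β α α′) (⊗-distribʳ β′ α α′))

  ⊕≉0 : ∀ α α′ → α′ < α → α ⊕ α′ ≉ 0#
  ⊕≉0 α α′ l e = <⇒≉ α′ α l (≈-sym (⊕≈0⇒≈ e))

  -- Unfolding an option of either side yields a smaller ordinal for each of the three factors.
  -- Equality with it would make the product of `α ⊕ α′`, `β ⊕ β′` and `γ ⊕ γ′` vanish, against
  -- `⊗-nonzero`.
  ⊗-assoc : ∀ α β γ → (α ⊗ β) ⊗ γ ≈ α ⊗ (β ⊗ γ)
  ⊗-assoc α β γ = go (<-wellFounded α) (<-wellFounded β) (<-wellFounded γ)
    where
    cancelˡ : ∀ a b c d e f g →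
      ((((((b ⊕ c) ⊕ d) ⊕ e) ⊕ ((f ⊕ g) ⊕ a)) ⊕ c) ⊕ (b ⊕ d)) ⊕ ((e ⊕ g) ⊕ (f ⊕ a)) ≈ 0#
    cancelˡ a b c d e f g = ≈-trans (⊕-solve 7 (λ a b c d e f g →
      ((((((b ⊞ c) ⊞ d) ⊞ e) ⊞ ((f ⊞ g) ⊞ a)) ⊞ c) ⊞ (b ⊞ d)) ⊞ ((e ⊞ g) ⊞ (f ⊞ a)) ⊜
      ((((((a ⊞ b) ⊞ c) ⊞ d) ⊞ e) ⊞ f) ⊞ g) ⊞ ((((((a ⊞ b) ⊞ c) ⊞ d) ⊞ e) ⊞ f) ⊞ g))
      ≈-refl a b c d e f g) (⊕-self _)

    cancelʳ : ∀ a b c d e f g →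
      ((((b ⊕ ((c ⊕ e) ⊕ g)) ⊕ ((d ⊕ f) ⊕ a)) ⊕ b) ⊕ (c ⊕ d)) ⊕ ((e ⊕ f) ⊕ (g ⊕ a)) ≈ 0#
    cancelʳ a b c d e f g = ≈-trans (⊕-solve 7 (λ a b c d e f g →
      ((((b ⊞ ((c ⊞ e) ⊞ g)) ⊞ ((d ⊞ f) ⊞ a)) ⊞ b) ⊞ (c ⊞ d)) ⊞ ((e ⊞ f) ⊞ (g ⊞ a)) ⊜
      ((((((a ⊞ b) ⊞ c) ⊞ d) ⊞ e) ⊞ f) ⊞ g) ⊞ ((((((a ⊞ b) ⊞ c) ⊞ d) ⊞ e) ⊞ f) ⊞ g))
      ≈-refl a b c d e f g) (⊕-self _)

    distrib₃ : ∀ {x y z w v} → v ≈ (x ⊕ y) ⊕ z → v ⊗ w ≈ (x ⊗ w ⊕ y ⊗ w) ⊕ z ⊗ w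
    distrib₃ {x} {y} {z} {w} e = ≈-trans (⊗-cong e ≈-refl)
      (≈-trans (⊗-distribʳ w (x ⊕ y) z) (⊕-cong (⊗-distribʳ w x y) ≈-refl))

    distrib₃′ : ∀ {x y z w v} → v ≈ (x ⊕ y) ⊕ z → w ⊗ v ≈ (w ⊗ x ⊕ w ⊗ y) ⊕ w ⊗ z
    distrib₃′ {x} {y} {z} {w} e = ≈-trans (⊗-cong ≈-refl e)
      (≈-trans (⊗-distribˡ w (x ⊕ y) z) (⊕-cong (⊗-distribˡ w x y) ≈-refl))

    go : ∀ {α β γ} → Acc _<_ α → Acc _<_ β → Acc _<_ γ → (α ⊗ β) ⊗ γ ≈ α ⊗ (β ⊗ γ)
    go {α} {β} {γ} a@(acc p) b@(acc q) c@(acc r) =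
      mex-≈ (⊗-isMex (α ⊗ β) γ) (⊗-isMex α (β ⊗ γ)) left right
      where
      left : ¬ ⊗-options (α ⊗ β) γ (α ⊗ (β ⊗ γ))
      left (η , γ′ , l , m , e) with ⊗-∋ l
      ... | α′ , β′ , lα , lβ , h = ⊗-nonzero (⊕≉0 α α′ lα)
        (⊗-nonzero (⊕≉0 β β′ lβ) (⊕≉0 γ γ′ m)) (begin
        (α ⊕ α′) ⊗ ((β ⊕ β′) ⊗ (γ ⊕ γ′))
          ≈⟨ ≈-trans (⊗-cong ≈-refl (⊗-distrib β β′ γ γ′)) (≈-trans (⊗-distrib α α′ _ _)
             (⊕-cong (⊕-cong (⊗-distribˡ α _ _) (⊗-distribˡ α′ _ _))
                     (⊕-cong (⊗-distribˡ α _ _) (⊗-distribˡ α′ _ _)))) ⟩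
        ((α ⊗ (β ⊗ γ) ⊕ α ⊗ (β′ ⊗ γ)) ⊕ (α′ ⊗ (β ⊗ γ) ⊕ α′ ⊗ (β′ ⊗ γ))) ⊕
        ((α ⊗ (β ⊗ γ′) ⊕ α ⊗ (β′ ⊗ γ′)) ⊕ (α′ ⊗ (β ⊗ γ′) ⊕ α′ ⊗ (β′ ⊗ γ′)))
          ≈⟨ ⊕-cong (⊕-cong (⊕-cong (≈-trans e (⊕-cong (⊕-cong
               (≈-trans (distrib₃ h) (⊕-cong (⊕-cong (go (p lα) b c) (go a (q lβ) c))
                                             (go (p lα) (q lβ) c)))
               (go a b (r m)))
               (≈-trans (distrib₃ h) (⊕-cong (⊕-cong (go (p lα) b (r m)) (go a (q lβ) (r m)))
                                             (go (p lα) (q lβ) (r m)))))) ≈-refl) ≈-refl) ≈-refl ⟩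
        -- The assumed equality has replaced the product without lowered factors by the seven
        -- others, so all terms cancel in pairs.
        _ ≈⟨ cancelˡ _ _ _ _ _ _ _ ⟩
        0# ∎)

      right : ¬ ⊗-options α (β ⊗ γ) ((α ⊗ β) ⊗ γ)
      right (α′ , η , l , m , e) with ⊗-∋ m
      ... | β′ , γ′ , lβ , lγ , h = ⊗-nonzero
        (⊗-nonzero (⊕≉0 α α′ l) (⊕≉0 β β′ lβ)) (⊕≉0 γ γ′ lγ) (begin
        ((α ⊕ α′) ⊗ (β ⊕ β′)) ⊗ (γ ⊕ γ′)
          ≈⟨ ≈-trans (⊗-cong (⊗-distrib α α′ β β′) ≈-refl) (≈-trans (⊗-distrib _ _ γ γ′)
             (⊕-cong (⊕-cong (⊗-distribʳ γ _ _) (⊗-distribʳ γ _ _))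
                     (⊕-cong (⊗-distribʳ γ′ _ _) (⊗-distribʳ γ′ _ _)))) ⟩
        (((α ⊗ β) ⊗ γ ⊕ (α′ ⊗ β) ⊗ γ) ⊕ ((α ⊗ β′) ⊗ γ ⊕ (α′ ⊗ β′) ⊗ γ)) ⊕
        (((α ⊗ β) ⊗ γ′ ⊕ (α′ ⊗ β) ⊗ γ′) ⊕ ((α ⊗ β′) ⊗ γ′ ⊕ (α′ ⊗ β′) ⊗ γ′))
          ≈⟨ ⊕-cong
               (⊕-cong
                 (⊕-cong (≈-trans e (⊕-cong (⊕-cong ≈-refl (distrib₃′ h)) (distrib₃′ h)))
                         (go (p l) b c))
                 (⊕-cong (go a (q lβ) c) (go (p l) (q lβ) c)))
               (⊕-cong
                 (⊕-cong (go a b (r lγ)) (go (p l) b (r lγ)))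
                 (⊕-cong (go a (q lβ) (r lγ)) (go (p l) (q lβ) (r lγ)))) ⟩
        _ ≈⟨ cancelʳ _ _ _ _ _ _ _ ⟩
        0# ∎)

  ⊗-identityˡ : ∀ α → 1# ⊗ α ≈ α
  ⊗-identityˡ α = ≈-trans (⊗-comm 1# α) (⊗-identityʳ α)

  -- Ring structure and ring solver

  nimCommutativeSemiring : CommutativeSemiring (lsuc 0ℓ) 0ℓ
  nimCommutativeSemiring = record
    { Carrier = Ord
    ; _≈_ = _≈_
    ; _+_ = _⊕_
    ; _*_ = _⊗_
    ; 0# = 0#
    ; 1# = 1#
    ; isCommutativeSemiring = record
      { isSemiring = record
        { isSemiringWithoutAnnihilatingZero = record
          { +-isCommutativeMonoid =
              CommutativeMonoid.isCommutativeMonoid ⊕-commutativeMonoid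
          ; *-cong = ⊗-cong
          ; *-assoc = ⊗-assoc
          ; *-identity = ⊗-identityˡ , ⊗-identityʳ
          ; distrib = ⊗-distribˡ , ⊗-distribʳ
          }
        ; zero = ⊗-zeroˡ , ⊗-zeroʳ
        }
      ; *-comm = ⊗-comm
      }
    }

  nimRing : AlmostCommutativeRing (lsuc 0ℓ) 0ℓ
  nimRing = fromCommutativeSemiring nimCommutativeSemiring

  𝔽₂ : RawRing 0ℓ 0ℓ
  𝔽₂ = record
    { Carrier = Bool ; _≈_ = _≡_ ; _+_ = _xor_ ; _*_ = _∧_ ; -_ = id ; 0# = false ; 1# = true }

  -- With coefficients in 𝔽₂, the ring solver decides identities that
  -- hold in characteristic 2.
  𝔽₂⟶nimRing : 𝔽₂ -Raw-AlmostCommutative⟶ nimRing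
  𝔽₂⟶nimRing = record
    { ⟦_⟧ = ⟦_⟧
    ; +-homo = λ { false _ → ≈-sym (⊕-identityˡ _)
                 ; true false → ≈-sym (⊕-identityʳ _)
                 ; true true → ≈-sym (⊕-self _) }
    ; *-homo = λ { false _ → ≈-sym (⊗-zeroˡ _) ; true _ → ≈-sym (⊗-identityˡ _) }
    ; -‿homo = λ _ → ≈-refl
    ; 0-homo = ≈-refl
    ; 1-homo = ≈-refl
    }
    where
    ⟦_⟧ : Bool → Ord
    ⟦ false ⟧ = 0#
    ⟦ true ⟧ = 1#

  _𝔽₂≟_ : WeaklyDecidable (Induced-equivalence 𝔽₂⟶nimRing)
  false 𝔽₂≟ false = just ≈-refl
  true  𝔽₂≟ true  = just ≈-refl
  _     𝔽₂≟ _     = nothing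

  open RingSolver 𝔽₂ nimRing 𝔽₂⟶nimRing _𝔽₂≟_
    using (solve; con; _:+_; _:*_; _:=_)

  -- Polynomials

  AllZero : ∀ {m} → Vec Ord m → Set₁
  AllZero = All (_≈ 0#)

  eval-zero : ∀ {m} {cs : Vec Ord m} x → AllZero cs → eval cs x ≈ 0#
  eval-zero x [] = ≈-refl
  eval-zero {cs = c ∷ cs} x (z ∷ zs) = begin
    c ⊕ x ⊗ eval cs x  ≈⟨ ⊕-cong z (⊗-cong ≈-refl (eval-zero x zs)) ⟩
    0# ⊕ x ⊗ 0#        ≈⟨ solve 1 (λ x → con false :+ x :* con false := con false) ≈-refl x ⟩
    0#                 ∎

  eval-cong : ∀ {m} {cs ds : Vec Ord m} {x y} → Pointwise _≈_ cs ds → x ≈ y →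
              eval cs x ≈ eval ds y
  eval-cong [] e = ≈-refl
  eval-cong (h ∷ hs) e = ⊕-cong h (⊗-cong e (eval-cong hs e))

  eval-congʳ : ∀ {m} (cs : Vec Ord m) {x y} → x ≈ y → eval cs x ≈ eval cs y
  eval-congʳ cs = eval-cong {cs = cs} {ds = cs} (Pointwise.refl ≈-refl)

  last-cong : ∀ {m} {cs ds : Vec Ord (suc m)} → Pointwise _≈_ cs ds → last cs ≈ last ds
  last-cong (h ∷ []) = h
  last-cong (_ ∷ h ∷ hs) = last-cong (h ∷ hs)

  last-zero : ∀ {m} {cs : Vec Ord (suc m)} → AllZero cs → last cs ≈ 0#
  last-zero (z ∷ []) = z
  last-zero (_ ∷ z ∷ zs) = last-zero (z ∷ zs)

  last∈ : ∀ {ℓ m} {F : Pred Ord ℓ} {cs : Vec Ord (suc m)} → All F cs → last cs ∈ F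
  last∈ (c ∷ []) = c
  last∈ (_ ∷ c ∷ cs) = last∈ (c ∷ cs)

  -- Arithmetic on coefficient vectors can leave zeros at the top, whereas `Polynomial` demands a
  -- nonzero leading coefficient. Dropping those zeros changes no value.
  trim : ∀ {ℓ m} {K : Pred Ord ℓ} {cs : Vec Ord m} → All K cs →
         AllZero cs ⊎ ∃ λ d → d ℕ.< m × Σ (Polynomial K d) λ p →
           ∀ x → eval (Polynomial.coeffs p) x ≈ eval cs x
  trim [] = inj₁ []
  trim {cs = c ∷ cs} (k ∷ ks) with trim ks
  ... | inj₂ (d , d<m , record { coeffs = es@(_ ∷ _) ; coeffs∈ = ls ; leading≉0 = l≉0 } , h) =
    inj₂ (suc d , s≤s d<m , record { coeffs = c ∷ es ; coeffs∈ = k ∷ ls ; leading≉0 = l≉0 } ,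
      λ x → ⊕-cong ≈-refl (⊗-cong ≈-refl (h x)))
  ... | inj₁ zs with em {P = c ≈ 0#}
  ...   | yes z = inj₁ (z ∷ zs)
  ...   | no c≉0 = inj₂ (0 , s≤s z≤n , record { coeffs = c ∷ [] ; coeffs∈ = k ∷ [] ; leading≉0 = c≉0 } ,
          λ x → ⊕-cong ≈-refl (⊗-cong ≈-refl (≈-sym (eval-zero x zs))))

  polynomial-⊆ : ∀ {r s d} {R : Pred Ord r} {S : Pred Ord s} (p : Polynomial R d) →
                 All S (Polynomial.coeffs p) → Polynomial S d
  polynomial-⊆ p coeffs∈S = record
    { coeffs = Polynomial.coeffs p
    ; coeffs∈ = coeffs∈S
    ; leading≉0 = Polynomial.leading≉0 p
    }

  -- Subrings and polynomial functions

  record IsSubring {ℓ} (R : Pred Ord ℓ) : Set (lsuc 0ℓ ⊔ ℓ) where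
    field
      respects : R Respects _≈_
      0∈       : 0# ∈ R
      1∈       : 1# ∈ R
      ⊕-closed : ∀ {α β} → α ∈ R → β ∈ R → α ⊕ β ∈ R
      ⊗-closed : ∀ {α β} → α ∈ R → β ∈ R → α ⊗ β ∈ R

  subfield⇒subring : ∀ {ℓ} {F : Pred Ord ℓ} → IsSubfield F → IsSubring F
  subfield⇒subring F-field = record { IsSubfield F-field }

  -- Here `k` counts coefficients, so the degree is below `k`. Zeros at the top are allowed, which
  -- gives closure under addition at fixed `k`.
  IsPolyFun : ∀ {ℓ} → Pred Ord ℓ → ℕ → (Ord → Ord) → Set (lsuc 0ℓ ⊔ ℓ)
  IsPolyFun R k φ = ∃ λ (cs : Vec Ord k) → All R cs × (∀ x → eval cs x ≈ φ x)

  -- For a ring `R` this is the `R`-module generated by the first `k` powers of `x`.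
  Values : ∀ {ℓ} → Pred Ord ℓ → Ord → ℕ → Pred Ord (lsuc 0ℓ ⊔ ℓ)
  Values R x k y = ∃ λ (cs : Vec Ord k) → All R cs × eval cs x ≈ y

  module PolyFun {ℓ} {R : Pred Ord ℓ} (R-ring : IsSubring R) where
    open IsSubring R-ring

    eval∈ : ∀ {m} {cs : Vec Ord m} {x} → All R cs → x ∈ R → eval cs x ∈ R
    eval∈ [] x∈ = 0∈
    eval∈ (c∈ ∷ cs∈) x∈ = ⊕-closed c∈ (⊗-closed x∈ (eval∈ cs∈ x∈))

    polyFun : ∀ {k} {cs : Vec Ord k} → All R cs → IsPolyFun R k (eval cs)
    polyFun cs∈ = _ , cs∈ , λ _ → ≈-refl

    value : ∀ {k φ} x → IsPolyFun R k φ → Values R x k (φ x)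
    value x (cs , cs∈ , e) = cs , cs∈ , e x

    cons : ∀ {k c φ} → c ∈ R → IsPolyFun R k φ → IsPolyFun R (suc k) (λ x → c ⊕ x ⊗ φ x)
    cons c∈ (cs , cs∈ , e) = _ ∷ cs , c∈ ∷ cs∈ , λ x → ⊕-cong ≈-refl (⊗-cong ≈-refl (e x))

    shift : ∀ {k φ} → IsPolyFun R k φ → IsPolyFun R (suc k) (λ x → x ⊗ φ x)
    shift f with cons 0∈ f
    ... | cs , cs∈ , e = cs , cs∈ , λ x → ≈-trans (e x) (⊕-identityˡ _)

    weaken : ∀ {k φ} → IsPolyFun R k φ → IsPolyFun R (suc k) φ
    weaken ([] , _ , e) = 0# ∷ [] , 0∈ ∷ [] , λ x →
      ≈-trans (solve 1 (λ x → con false :+ x :* con false := con false) ≈-refl x) (e x)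
    weaken (c ∷ cs , c∈ ∷ cs∈ , e) with weaken (polyFun cs∈)
    ... | ds , ds∈ , h = c ∷ ds , c∈ ∷ ds∈ , λ x →
      ≈-trans (⊕-cong ≈-refl (⊗-cong ≈-refl (h x))) (e x)

    add : ∀ {k φ ψ} → IsPolyFun R k φ → IsPolyFun R k ψ → IsPolyFun R k (λ x → φ x ⊕ ψ x)
    add ([] , _ , e) ([] , _ , h) = [] , [] , λ x →
      ≈-trans (≈-sym (⊕-identityˡ 0#)) (⊕-cong (e x) (h x))
    add (c ∷ cs , c∈ ∷ cs∈ , e) (d ∷ ds , d∈ ∷ ds∈ , h) with add (polyFun cs∈) (polyFun ds∈)
    ... | es , es∈ , f = c ⊕ d ∷ es , ⊕-closed c∈ d∈ ∷ es∈ , λ x →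
      ≈-trans (⊕-cong ≈-refl (⊗-cong ≈-refl (f x)))
        (≈-trans (solve 5 (λ c d x u v → (c :+ d) :+ x :* (u :+ v) := (c :+ x :* u) :+ (d :+ x :* v))
                   ≈-refl c d x (eval cs x) (eval ds x))
                 (⊕-cong (e x) (h x)))

    scale : ∀ {k a φ} → a ∈ R → IsPolyFun R k φ → IsPolyFun R k (λ x → a ⊗ φ x)
    scale {a = a} a∈ ([] , _ , e) = [] , [] , λ x →
      ≈-trans (≈-sym (⊗-zeroʳ a)) (⊗-cong ≈-refl (e x))
    scale {a = a} a∈ (c ∷ cs , c∈ ∷ cs∈ , e) with scale a∈ (polyFun cs∈)
    ... | es , es∈ , f = a ⊗ c ∷ es , ⊗-closed a∈ c∈ ∷ es∈ , λ x →
      ≈-trans (⊕-cong ≈-refl (⊗-cong ≈-refl (f x)))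
        (≈-trans (solve 4 (λ a c x u → a :* c :+ x :* (a :* u) := a :* (c :+ x :* u))
                   ≈-refl a c x (eval cs x))
                 (⊗-cong ≈-refl (e x)))

  -- Division by X ⊕ r: the coefficients of the quotient are the
  -- intermediate results of Horner's scheme at r.
  quotient : ∀ {m} → Ord → Vec Ord (suc m) → Vec Ord m
  quotient r (c ∷ []) = []
  quotient r (c ∷ cs@(_ ∷ _)) = eval cs r ∷ quotient r cs

  eval-quotient : ∀ {m} r (cs : Vec Ord (suc m)) x →
                  eval cs x ≈ eval cs r ⊕ (x ⊕ r) ⊗ eval (quotient r cs) x
  eval-quotient r (c ∷ []) x =
    solve 3 (λ c x r → c :+ x :* con false := (c :+ r :* con false) :+ (x :+ r) :* con false)
      ≈-refl c x r
  eval-quotient r (c ∷ cs@(_ ∷ _)) x = ≈-trans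
    (⊕-cong ≈-refl (⊗-cong ≈-refl (eval-quotient r cs x)))
    (solve 5 (λ c x r u v → c :+ x :* (u :+ (x :+ r) :* v) :=
                            (c :+ r :* u) :+ (x :+ r) :* (u :+ x :* v))
      ≈-refl c x r (eval cs r) (eval (quotient r cs) x))

  last-quotient : ∀ {m} r (cs : Vec Ord (suc (suc m))) → last (quotient r cs) ≈ last cs
  last-quotient r (c ∷ d ∷ []) = solve 2 (λ d r → d :+ r :* con false := d) ≈-refl d r
  last-quotient r (c ∷ cs@(_ ∷ _ ∷ _)) = last-quotient r cs

  -- At a root `r` the remainder in `eval-quotient` vanishes, and a product is zero only if a factor
  -- is.
  root-quotient : ∀ {m} r (cs : Vec Ord (suc m)) x → eval cs r ≈ 0# → eval cs x ≈ 0# →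
                  x ≈ r ⊎ eval (quotient r cs) x ≈ 0#
  root-quotient r cs x er ex with em {P = x ≈ r} | em {P = eval (quotient r cs) x ≈ 0#}
  ... | yes e | _ = inj₁ e
  ... | no _ | yes h = inj₂ h
  ... | no x≉r | no h = ⊥-elim (⊗-nonzero (x≉r ∘ ⊕≈0⇒≈) h (begin
    (x ⊕ r) ⊗ eval (quotient r cs) x              ≈⟨ ⊕-identityˡ _ ⟨
    0# ⊕ (x ⊕ r) ⊗ eval (quotient r cs) x         ≈⟨ ⊕-cong er ≈-refl ⟨
    eval cs r ⊕ (x ⊕ r) ⊗ eval (quotient r cs) x  ≈⟨ eval-quotient r cs x ⟨
    eval cs x                                     ≈⟨ ex ⟩
    0#                                            ∎))

  constant≉0 : ∀ {c} x → c ≉ 0# → eval (c ∷ []) x ≉ 0#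
  constant≉0 {c} x c≉0 e = c≉0
    (≈-trans (solve 2 (λ c x → c := c :+ x :* con false) ≈-refl c x) e)

  -- Induction on the degree: once a root `r` is divided out, every other root is a root of the
  -- quotient, so `r` and the bound for the quotient together suffice.
  rootBound : ∀ {m} (cs : Vec Ord (suc m)) → last cs ≉ 0# →
              ∃ λ β → ∀ x → eval cs x ≈ 0# → x ≤ β
  rootBound (c ∷ []) c≉0 = 0# , λ x e → ⊥-elim (constant≉0 x c≉0 e)
  rootBound cs@(_ ∷ _ ∷ _) l≉0 with em {P = ∃ λ r → eval cs r ≈ 0#}
  ... | no ¬root = 0# , λ x e → ⊥-elim (¬root (x , e))
  ... | yes (r , er) with rootBound (quotient r cs) (l≉0 ∘ ≈-trans (≈-sym (last-quotient r cs)))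
  ...   | β , x≤β = sup Bool bound , λ x e → <⇒≤ {x} {sup Bool bound} (bounded x e)
    where
    bound : Bool → Ord
    bound true = r
    bound false = β
    bounded : ∀ x → eval cs x ≈ 0# → x < sup Bool bound
    bounded x e with root-quotient r cs x er e
    ... | inj₁ x≈r = true , ≈⇒≤ x≈r
    ... | inj₂ h = false , x≤β x h

  module _ {ℓ n} {F : Pred Ord ℓ} (F-ring : IsSubring F) (F-closed : IsNClosed n F) where
    open IsSubring F-ring
    open PolyFun F-ring using (eval∈)

    quotient∈ : ∀ {m r} {cs : Vec Ord (suc m)} → r ∈ F → All F cs → All F (quotient r cs)
    quotient∈ r∈ (_ ∷ []) = []
    quotient∈ r∈ (_ ∷ cs∈@(_ ∷ _)) = eval∈ cs∈ r∈ ∷ quotient∈ r∈ cs∈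

    -- Closedness supplies just one root in `F`. Dividing by it leaves a polynomial over `F` of
    -- lower degree, so induction captures every root in the class of ordinals.
    nClosed⇒roots∈ : ∀ d → d ℕ.≤ n → (p : Polynomial F d) → ∀ x → IsRoot p x → x ∈ F
    nClosed⇒roots∈ zero _ record { coeffs = c ∷ [] ; leading≉0 = c≉0 } x e =
      ⊥-elim (constant≉0 x c≉0 e)
    nClosed⇒roots∈ (suc d) d<n p x e with F-closed (suc d) (s≤s z≤n) d<n p
    ... | r , r∈ , er with root-quotient r (Polynomial.coeffs p) x er e
    ...   | inj₁ x≈r = respects (≈-sym x≈r) r∈
    ...   | inj₂ h = nClosed⇒roots∈ d (ℕₚ.<⇒≤ d<n) (record
            { coeffs = quotient r (Polynomial.coeffs p)
            ; coeffs∈ = quotient∈ r∈ (Polynomial.coeffs∈ p)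
            ; leading≉0 = Polynomial.leading≉0 p ∘
                ≈-trans (≈-sym (last-quotient r (Polynomial.coeffs p)))
            }) x h

  -- Simplest extensions

  ≤∧≉⇒< : ∀ α β → α ≤ β → β ≉ α → α < β
  ≤∧≉⇒< α β α≤β β≉α with ≉⇒≶ α β (β≉α ∘ ≈-sym)
  ... | inj₁ l = l
  ... | inj₂ l = ⊥-elim (<-irrefl {β} (<-≤-trans {β} {α} {β} l α≤β))

  -- By induction all options of `α ⊕ β` are below `Δ`, so `Δ` is not an option and the mex is at
  -- most `Δ`; equality is excluded by hypothesis. Products follow the same argument.
  ⊕-closed↓ : ∀ Δ → (∀ {α β} → α < Δ → β < Δ → Δ ≉ α ⊕ β) →
              ∀ {α β} → α < Δ → β < Δ → α ⊕ β < Δ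
  ⊕-closed↓ Δ ⊕≉Δ = go (<-wellFounded _) (<-wellFounded _)
    where
    go : ∀ {α β} → Acc _<_ α → Acc _<_ β → α < Δ → β < Δ → α ⊕ β < Δ
    go {α} {β} a@(acc p) b@(acc q) l m = ≤∧≉⇒< (α ⊕ β) Δ (proj₂ (⊕-isMex α β) Δ λ
      { (inj₁ (α′ , l′ , e)) → <⇒≉ _ Δ (go (p l′) b (<-trans Δ {α} l l′) m) (≈-sym e)
      ; (inj₂ (β′ , m′ , e)) → <⇒≉ _ Δ (go a (q m′) l (<-trans Δ {β} m m′)) (≈-sym e) })
      (⊕≉Δ l m)

  ⊗-closed↓ : ∀ Δ → (∀ {α β} → α < Δ → β < Δ → α ⊕ β < Δ) →
              (∀ {α β} → α < Δ → β < Δ → Δ ≉ α ⊗ β) →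
              ∀ {α β} → α < Δ → β < Δ → α ⊗ β < Δ
  ⊗-closed↓ Δ ⊕-closed ⊗≉Δ = go (<-wellFounded _) (<-wellFounded _)
    where
    go : ∀ {α β} → Acc _<_ α → Acc _<_ β → α < Δ → β < Δ → α ⊗ β < Δ
    go {α} {β} a@(acc p) b@(acc q) l m = ≤∧≉⇒< (α ⊗ β) Δ
      (proj₂ (⊗-isMex α β) Δ λ (α′ , β′ , l′ , m′ , e) →
        <⇒≉ _ Δ (⊕-closed
          (⊕-closed (go (p l′) b (<-trans Δ {α} l l′) m) (go a (q m′) l (<-trans Δ {β} m m′)))
          (go (p l′) (q m′) (<-trans Δ {α} l l′) (<-trans Δ {β} m m′))) (≈-sym e))
      (⊗≉Δ l m)

  record IsNTranscendental (n : ℕ) (Δ : Ord) : Set₁ where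
    field
      1<Δ    : 1# < Δ
      Δ≉⊕    : ∀ {α β} → α < Δ → β < Δ → Δ ≉ α ⊕ β
      Δ≉⊗    : ∀ {α β} → α < Δ → β < Δ → Δ ≉ α ⊗ β
      ¬root  : ∀ d → 1 ℕ.≤ d → d ℕ.≤ n → (p : Polynomial (↓ Δ) d) → ¬ IsRoot p Δ

  module _ {n Δ} (Δ-trans : IsNTranscendental n Δ) where
    open IsNTranscendental Δ-trans

    ↓-isSubring : IsSubring (↓ Δ)
    ↓-isSubring = record
      { respects = <-respˡ Δ
      ; 0∈ = ≤-<-trans {0#} {1#} {Δ} (0≤ 1#) 1<Δ
      ; 1∈ = 1<Δ
      ; ⊕-closed = ⊕-closed↓ Δ Δ≉⊕
      ; ⊗-closed = ⊗-closed↓ Δ (⊕-closed↓ Δ Δ≉⊕) Δ≉⊗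
      }

    open PolyFun ↓-isSubring

    -- An ordinal below `c ⊕ Δ ⊗ eval cs Δ` either lowers `c`, giving another coefficient below `Δ`,
    -- or lowers the product to an option with some `δ < Δ` and `ρ < eval cs Δ`. By induction `ρ` is
    -- a value, and the option rearranges into a value of the same length.
    values-initial : ∀ k {π η} → π ∈ Values (↓ Δ) Δ k → η < π → η ∈ Values (↓ Δ) Δ k
    values-initial zero {π} {η} ([] , _ , e) l =
      ⊥-elim (≮0 η (<-≤-trans {η} {π} {0#} l (≈⇒≥ e)))
    values-initial (suc k) {π} {η} (c ∷ cs , c∈ ∷ cs∈ , e) l
      with mex-∋ (c ⊕ Δ ⊗ eval cs Δ) (⊕-isMex c (Δ ⊗ eval cs Δ))
             (<-≤-trans {η} {π} {c ⊕ Δ ⊗ eval cs Δ} l (≈⇒≥ e))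
    ... | inj₁ (c′ , c′<c , h) =
      c′ ∷ cs , <-trans Δ {c} c∈ c′<c ∷ cs∈ , ≈-sym h
    ... | inj₂ (ζ , ζ< , h) with ⊗-∋ ζ<
    ...   | δ , ρ , δ<Δ , ρ< , h′ with values-initial k (cs , cs∈ , ≈-refl) ρ<
    ...     | ds , ds∈ , h″
          -- The target is `c ⊕ Δ ⊗ ρ ⊕ δ ⊗ (eval cs Δ ⊕ ρ)`. Scaling by `δ` does not lengthen the
          -- vector, hence the `weaken` to match `cons`.
          with value Δ (add (cons c∈ (polyFun ds∈))
                            (weaken (scale δ<Δ (add (polyFun cs∈) (polyFun ds∈)))))
    ...       | es , es∈ , f = es , es∈ , (begin
      eval es Δ
        ≈⟨ f ⟩
      (c ⊕ Δ ⊗ eval ds Δ) ⊕ δ ⊗ (eval cs Δ ⊕ eval ds Δ)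
        ≈⟨ ⊕-cong (⊕-cong ≈-refl (⊗-cong ≈-refl h″)) (⊗-cong ≈-refl (⊕-cong ≈-refl h″)) ⟩
      (c ⊕ Δ ⊗ ρ) ⊕ δ ⊗ (eval cs Δ ⊕ ρ)
        ≈⟨ solve 5 (λ c Δ δ π ρ → (c :+ Δ :* ρ) :+ δ :* (π :+ ρ) :=
                                  c :+ (δ :* π :+ Δ :* ρ :+ δ :* ρ))
             ≈-refl c Δ δ (eval cs Δ) ρ ⟩
      c ⊕ (δ ⊗ eval cs Δ ⊕ Δ ⊗ ρ ⊕ δ ⊗ ρ)
        ≈⟨ ⊕-cong ≈-refl h′ ⟨
      c ⊕ ζ
        ≈⟨ h ⟨
      η ∎)

    -- With at most `suc n` coefficients the degree is at most `n`; a nonzero vector would trim to a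
    -- nonzero constant or to a polynomial excluded by `¬root`. An identity at `Δ` thus becomes one
    -- at every argument.
    vanishing : ∀ {m} {cs : Vec Ord m} → m ℕ.≤ suc n → All (↓ Δ) cs → eval cs Δ ≈ 0# → AllZero cs
    vanishing m≤1+n cs∈ e with trim cs∈
    ... | inj₁ z = z
    ... | inj₂ (zero , _ , record { coeffs = c ∷ [] ; leading≉0 = c≉0 } , h) =
      ⊥-elim (constant≉0 Δ c≉0 (≈-trans (h Δ) e))
    ... | inj₂ (suc d , d<m , p , h) = ⊥-elim (¬root (suc d) (s≤s z≤n)
      (ℕ.s≤s⁻¹ (ℕₚ.≤-trans d<m m≤1+n)) p (≈-trans (h Δ) e))

    ↓-isNClosed : IsNClosed n (↓ Δ)
    ↓-isNClosed (suc d) _ d<n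
      record { coeffs = c ∷ cs@(_ ∷ _) ; coeffs∈ = c∈ ∷ cs∈ ; leading≉0 = l≉0 } =
      δ , δ<Δ , (begin
        c ⊕ δ ⊗ eval cs δ
          ≈⟨ solve 4 (λ c δ u v → c :+ δ :* u :=
                       (c :+ δ :* u) :+ (δ :* (u :+ v) :+ δ :* (u :+ v)))
               ≈-refl c δ (eval cs δ) (eval ds δ) ⟩
        diff δ
          ≈⟨ f δ ⟨
        eval es δ
          ≈⟨ eval-zero δ (vanishing (s≤s d<n) es∈ (≈-trans (f Δ) diffΔ)) ⟩
        0# ∎)
      where
      ρ = eval cs Δ

      -- Otherwise `Δ ⊗ ρ` is below `Δ` and may serve as constant coefficient: `Δ ⊗ ρ ∷ cs` vanishes
      -- at `Δ`, so `last cs` would be zero.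
      c<Δρ : c < Δ ⊗ ρ
      c<Δρ = decidable-stable em λ ¬l →
        let Δρ<Δ = ≤-<-trans {Δ ⊗ ρ} {c} {Δ} (≮⇒≥ c (Δ ⊗ ρ) ¬l) c∈ in
        l≉0 (last-zero (All.tail (vanishing {cs = Δ ⊗ ρ ∷ cs} (s≤s d<n) (Δρ<Δ ∷ cs∈)
          (⊕-self (Δ ⊗ ρ)))))

      option = ⊗-∋ c<Δρ
      δ = proj₁ option
      ρ′ = proj₁ (proj₂ option)

      δ<Δ : δ < Δ
      δ<Δ = proj₁ (proj₂ (proj₂ option))

      c≈ : c ≈ (δ ⊗ ρ) ⊕ (Δ ⊗ ρ′) ⊕ (δ ⊗ ρ′)
      c≈ = proj₂ (proj₂ (proj₂ (proj₂ option)))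

      ρ′-value : ρ′ ∈ Values (↓ Δ) Δ (suc d)
      ρ′-value = values-initial (suc d) (cs , cs∈ , ≈-refl)
        (proj₁ (proj₂ (proj₂ (proj₂ option))))

      ds = proj₁ ρ′-value

      -- The given polynomial plus the expanded product of `x ⊕ δ` and `eval cs x ⊕ eval ds x`. It
      -- vanishes at `Δ`, hence identically; at `δ` the product drops out, so `δ` is a root.
      diff : Ord → Ord
      diff x = (c ⊕ x ⊗ eval cs x) ⊕ (x ⊗ (eval cs x ⊕ eval ds x) ⊕ δ ⊗ (eval cs x ⊕ eval ds x))

      diff-polyFun : IsPolyFun (↓ Δ) (suc (suc d)) diff
      diff-polyFun = add (cons c∈ (polyFun cs∈)) (add (shift s) (weaken (scale δ<Δ s)))
        where s = add (polyFun cs∈) (polyFun (proj₁ (proj₂ ρ′-value)))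

      es = proj₁ diff-polyFun
      es∈ = proj₁ (proj₂ diff-polyFun)
      f = proj₂ (proj₂ diff-polyFun)

      diffΔ : diff Δ ≈ 0#
      diffΔ = begin
        (c ⊕ Δ ⊗ ρ) ⊕ (Δ ⊗ (ρ ⊕ eval ds Δ) ⊕ δ ⊗ (ρ ⊕ eval ds Δ))
          ≈⟨ ⊕-cong (⊕-cong c≈ ≈-refl) (⊕-cong (⊗-cong ≈-refl ρ+) (⊗-cong ≈-refl ρ+)) ⟩
        ((δ ⊗ ρ ⊕ Δ ⊗ ρ′ ⊕ δ ⊗ ρ′) ⊕ Δ ⊗ ρ) ⊕ (Δ ⊗ (ρ ⊕ ρ′) ⊕ δ ⊗ (ρ ⊕ ρ′))
          ≈⟨ solve 4 (λ δ Δ ρ ρ′ →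
               ((δ :* ρ :+ Δ :* ρ′ :+ δ :* ρ′) :+ Δ :* ρ) :+ (Δ :* (ρ :+ ρ′) :+ δ :* (ρ :+ ρ′))
               := con false) ≈-refl δ Δ ρ ρ′ ⟩
        0# ∎
        where
        ρ+ : ρ ⊕ eval ds Δ ≈ ρ ⊕ ρ′
        ρ+ = ⊕-cong ≈-refl (proj₂ (proj₂ ρ′-value))

    -- In characteristic 2 each element is its own negative. The inverse of `α` is a root of the
    -- linear polynomial `1 ⊕ α X`.
    ↓-isSubfield : 1 ℕ.≤ n → IsSubfield (↓ Δ)
    ↓-isSubfield 1≤n = record
      { IsSubring ↓-isSubring
      ; negatives = λ {α} α∈ → α , α∈ , ⊕-self α
      ; inverses = λ {α} α∈ α≉0 →
          let x , x∈ , e = ↓-isNClosed 1 (s≤s z≤n) 1≤n (record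
                { coeffs = 1# ∷ α ∷ []
                ; coeffs∈ = 1<Δ ∷ α∈ ∷ []
                ; leading≉0 = α≉0
                })
          in x , x∈ , ≈-sym (⊕≈0⇒≈ (≈-trans
               (solve 2 (λ α x → con true :+ α :* x :=
                                 con true :+ x :* (α :+ x :* con false)) ≈-refl α x) e))
      }

  -- Algebraic elements

  0<1 : 0# < 1#
  0<1 = child< _ _

  1≉0 : 1# ≉ 0#
  1≉0 = <⇒≉ 0# 1# 0<1 ∘ ≈-sym

  open import Algebra.Properties.Semiring.Exp
    (CommutativeSemiring.semiring nimCommutativeSemiring) using (_^_)

  -- Linear combinations and powers

  dot : ∀ {m} → Vec Ord m → Vec Ord m → Ord
  dot [] [] = 0#
  dot (c ∷ cs) (x ∷ xs) = c ⊗ x ⊕ dot cs xs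

  dot-add : ∀ {m} (cs ds xs : Vec Ord m) → dot (zipWith _⊕_ cs ds) xs ≈ dot cs xs ⊕ dot ds xs
  dot-add [] [] [] = ≈-sym (⊕-identityˡ 0#)
  dot-add (c ∷ cs) (d ∷ ds) (x ∷ xs) = ≈-trans (⊕-cong ≈-refl (dot-add cs ds xs))
    (solve 5 (λ c d x u v → (c :+ d) :* x :+ (u :+ v) := (c :* x :+ u) :+ (d :* x :+ v))
      ≈-refl c d x (dot cs xs) (dot ds xs))

  dot-scaleˡ : ∀ {m} a (cs xs : Vec Ord m) → dot (map (a ⊗_) cs) xs ≈ a ⊗ dot cs xs
  dot-scaleˡ a [] [] = ≈-sym (⊗-zeroʳ a)
  dot-scaleˡ a (c ∷ cs) (x ∷ xs) = ≈-trans (⊕-cong ≈-refl (dot-scaleˡ a cs xs))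
    (solve 4 (λ a c x u → (a :* c) :* x :+ a :* u := a :* (c :* x :+ u))
      ≈-refl a c x (dot cs xs))

  dot-scaleʳ : ∀ {m} a (cs xs : Vec Ord m) → dot cs (map (a ⊗_) xs) ≈ a ⊗ dot cs xs
  dot-scaleʳ a [] [] = ≈-sym (⊗-zeroʳ a)
  dot-scaleʳ a (c ∷ cs) (x ∷ xs) = ≈-trans (⊕-cong ≈-refl (dot-scaleʳ a cs xs))
    (solve 4 (λ a c x u → c :* (a :* x) :+ a :* u := a :* (c :* x :+ u))
      ≈-refl a c x (dot cs xs))

  dot-++ : ∀ {m n} (cs xs : Vec Ord m) (ds ys : Vec Ord n) →
           dot (cs ++ ds) (xs ++ ys) ≈ dot cs xs ⊕ dot ds ys
  dot-++ [] [] ds ys = ≈-sym (⊕-identityˡ _)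
  dot-++ (c ∷ cs) (x ∷ xs) ds ys = ≈-trans (⊕-cong ≈-refl (dot-++ cs xs ds ys))
    (≈-sym (⊕-assoc (c ⊗ x) (dot cs xs) (dot ds ys)))

  powers : Ord → ∀ m → Vec Ord m
  powers x zero = []
  powers x (suc m) = 1# ∷ map (x ⊗_) (powers x m)

  -- Turns a linear relation between powers of `x` into a polynomial with root `x`.
  dot-powers : ∀ {m} (cs : Vec Ord m) x → dot cs (powers x m) ≈ eval cs x
  dot-powers [] x = ≈-refl
  dot-powers (c ∷ cs) x = ⊕-cong (⊗-identityʳ c)
    (≈-trans (dot-scaleʳ x cs (powers x _)) (⊗-cong ≈-refl (dot-powers cs x)))

  module _ {ℓ} {R : Pred Ord ℓ} (R-ring : IsSubring R) where
    open IsSubring R-ring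

    powers∈ : ∀ {x} → x ∈ R → ∀ m → All R (powers x m)
    powers∈ x∈ zero = []
    powers∈ x∈ (suc m) = 1∈ ∷ map⁺ (All.map (⊗-closed x∈) (powers∈ x∈ m))

  -- Horner's form nests the top monomial; separating it allows it to be rewritten in lower powers.
  split-last : ∀ {ℓ m} {R : Pred Ord ℓ} {cs : Vec Ord (suc m)} → All R cs →
               ∃ λ (ds : Vec Ord m) → All R ds × (∀ x → eval cs x ≈ eval ds x ⊕ last cs ⊗ x ^ m)
  split-last {cs = c ∷ []} _ = [] , [] , λ x →
    solve 2 (λ c x → c :+ x :* con false := con false :+ c :* con true) ≈-refl c x
  split-last {m = suc m} {cs = c ∷ cs@(_ ∷ _)} (c∈ ∷ cs∈) with split-last cs∈
  ... | ds , ds∈ , e = c ∷ ds , c∈ ∷ ds∈ , λ x → ≈-trans (⊕-cong ≈-refl (⊗-cong ≈-refl (e x)))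
    (solve 5 (λ c x u l y → c :+ x :* (u :+ l :* y) := (c :+ x :* u) :+ l :* (x :* y))
      ≈-refl c x (eval ds x) (last cs) (x ^ m))

  -- Linear dependence over a subfield

  module _ {k} {K : Pred Ord k} (K-field : IsSubfield K) where
    open IsSubfield K-field using (0∈; 1∈; ⊕-closed; ⊗-closed; inverses)

    Span : ∀ {m} → Vec Ord m → Pred Ord (lsuc 0ℓ ⊔ k)
    Span {m} vs x = ∃ λ (cs : Vec Ord m) → All K cs × x ≈ dot cs vs

    Span-⊕ : ∀ {m} {vs : Vec Ord m} {x y} → x ∈ Span vs → y ∈ Span vs → x ⊕ y ∈ Span vs
    Span-⊕ {vs = vs} (cs , cs∈ , e) (ds , ds∈ , h) =
      zipWith _⊕_ cs ds , All.zipWith ⊕-closed cs∈ ds∈ ,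
      ≈-trans (⊕-cong e h) (≈-sym (dot-add cs ds vs))

    Span-scale : ∀ {m} {vs : Vec Ord m} {a x} → a ∈ K → x ∈ Span vs → a ⊗ x ∈ Span vs
    Span-scale {vs = vs} {a} a∈ (cs , cs∈ , e) =
      map (a ⊗_) cs , map⁺ (All.map (⊗-closed a∈) cs∈) ,
      ≈-trans (⊗-cong ≈-refl e) (≈-sym (dot-scaleˡ a cs vs))

    Span-resp : ∀ {m} {vs : Vec Ord m} → Span vs Respects _≈_
    Span-resp e (cs , cs∈ , h) = cs , cs∈ , ≈-trans (≈-sym e) h

    -- The row operation that adds multiples of `x₀` to the other vectors. In a combination of the
    -- new vectors these multiples collect into the single coefficient `s`.
    sweep : ∀ {m l} {vs : Vec Ord m} x₀ {xs : Vec Ord l} →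
            All (λ x → ∃ λ t → t ∈ K × x ⊕ t ⊗ x₀ ∈ Span vs) xs →
            ∃ λ (zs : Vec Ord l) → All (Span vs) zs ×
              (∀ {cs} → All K cs → ∃ λ s → s ∈ K × dot cs zs ≈ s ⊗ x₀ ⊕ dot cs xs)
    sweep x₀ [] = [] , [] , λ { [] → 0# , 0∈ ,
      solve 1 (λ x → con false := con false :* x :+ con false) ≈-refl x₀ }
    sweep x₀ {x ∷ xs} ((t , t∈ , x∈) ∷ hs) with sweep x₀ hs
    ... | zs , zs∈ , f = x ⊕ t ⊗ x₀ ∷ zs , x∈ ∷ zs∈ , λ { {c ∷ cs} (c∈ ∷ cs∈) →
      let s , s∈ , e = f cs∈ in
      c ⊗ t ⊕ s , ⊕-closed (⊗-closed c∈ t∈) s∈ ,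
      ≈-trans (⊕-cong ≈-refl e)
        (solve 6 (λ c x t x₀ s u → c :* (x :+ t :* x₀) :+ (s :* x₀ :+ u) :=
                                   (c :* t :+ s) :* x₀ :+ (c :* x :+ u))
          ≈-refl c x t x₀ s (dot cs xs)) }

    -- One step of Gaussian elimination: the generator v is traded for one
    -- of the vectors.
    eliminate : ∀ {m l} {v} {vs : Vec Ord m} {xs : Vec Ord (suc l)} →
                All (Span (v ∷ vs)) xs →
                ∃ λ (zs : Vec Ord l) → All (Span vs) zs ×
                  (∀ {cs} → All K cs → ∃ λ ds → All K ds × (AllZero ds → AllZero cs) ×
                                               dot cs zs ≈ dot ds xs)
    eliminate {v = v} {vs} {x₀ ∷ xs} ((a₀ ∷ as₀ , a₀∈ ∷ as₀∈ , e₀) ∷ hs) with em {P = a₀ ≈ 0#}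
    ... | no a₀≉0 =
      let zs , zs∈ , f = sweep x₀ (All.map reduce hs) in
      zs , zs∈ , λ {cs} cs∈ → let s , s∈ , e = f cs∈ in s ∷ cs , s∈ ∷ cs∈ , All.tail , e
      where
      reduce : ∀ {x} → x ∈ Span (v ∷ vs) → ∃ λ t → t ∈ K × x ⊕ t ⊗ x₀ ∈ Span vs
      reduce {x} (a ∷ as , a∈ ∷ as∈ , e) =
        let i , i∈ , h = inverses a₀∈ a₀≉0
            -- Since `i` inverts the pivot `a₀`, adding `t ⊗ x₀` cancels the `v`-coefficient `a`.
            t = a ⊗ i
            t∈ = ⊗-closed a∈ i∈
            y = dot as vs
            y₀ = dot as₀ vs
        in t , t∈ , Span-resp (≈-sym (begin
          x ⊕ t ⊗ x₀
            ≈⟨ ⊕-cong e (⊗-cong ≈-refl e₀) ⟩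
          (a ⊗ v ⊕ y) ⊕ (a ⊗ i) ⊗ (a₀ ⊗ v ⊕ y₀)
            ≈⟨ solve 6 (λ a v y i a₀ y₀ → (a :* v :+ y) :+ (a :* i) :* (a₀ :* v :+ y₀) :=
                 (a :* v :+ (a₀ :* i) :* (a :* v)) :+ (y :+ (a :* i) :* y₀)) ≈-refl a v y i a₀ y₀ ⟩
          (a ⊗ v ⊕ (a₀ ⊗ i) ⊗ (a ⊗ v)) ⊕ (y ⊕ t ⊗ y₀)
            ≈⟨ ⊕-cong (⊕-cong ≈-refl (⊗-cong h ≈-refl)) ≈-refl ⟩
          (a ⊗ v ⊕ 1# ⊗ (a ⊗ v)) ⊕ (y ⊕ t ⊗ y₀)
            ≈⟨ solve 2 (λ u w → (u :+ con true :* u) :+ w := w) ≈-refl (a ⊗ v) (y ⊕ t ⊗ y₀) ⟩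
          y ⊕ t ⊗ y₀ ∎)) (Span-⊕ (as , as∈ , ≈-refl) (Span-scale t∈ (as₀ , as₀∈ , ≈-refl)))
    eliminate {xs = x₀ ∷ []} _ | yes _ = [] , [] , λ { [] →
      0# ∷ [] , 0∈ ∷ [] , All.tail ,
      solve 1 (λ x → con false := con false :* x :+ con false) ≈-refl x₀ }
    -- Here `x₀` has no `v`-component: it is kept, and the pivot is sought among the remaining
    -- vectors.
    eliminate {v = v} {vs} {x₀ ∷ _ ∷ _} ((_ ∷ as₀ , _ ∷ as₀∈ , e₀) ∷ hs) | yes a₀≈0 =
      let zs , zs∈ , f = eliminate hs in
      x₀ ∷ zs ,
      (as₀ , as₀∈ , ≈-trans e₀ (≈-trans (⊕-cong (⊗-cong a₀≈0 ≈-refl) ≈-refl)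
        (solve 2 (λ v y → con false :* v :+ y := y) ≈-refl v (dot as₀ vs)))) ∷ zs∈ ,
      λ { {c ∷ cs} (c∈ ∷ cs∈) → let ds , ds∈ , z , e = f cs∈ in
        c ∷ ds , c∈ ∷ ds∈ , (λ { (c≈0 ∷ ds≈0) → c≈0 ∷ z ds≈0 }) , ⊕-cong ≈-refl e }

    -- Induction on the generators: `eliminate` removes one generator and one vector, and a
    -- nontrivial relation between the new vectors pulls back to the old ones. Without generators
    -- the single vector is zero.
    dependent : ∀ {m} (vs : Vec Ord m) {xs : Vec Ord (suc m)} → All (Span vs) xs →
                ∃ λ cs → All K cs × ¬ AllZero cs × dot cs xs ≈ 0#
    dependent [] {x ∷ []} (([] , _ , e) ∷ []) =
      1# ∷ [] , 1∈ ∷ [] , 1≉0 ∘ All.head ,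
      ≈-trans (solve 1 (λ x → con true :* x :+ con false := x) ≈-refl x) e
    dependent (v ∷ vs) xs∈ =
      let zs , zs∈ , f = eliminate xs∈
          cs , cs∈ , cs≉0 , e = dependent vs zs∈
          ds , ds∈ , z , h = f cs∈
      in ds , ds∈ , cs≉0 ∘ z , ≈-trans (≈-sym h) e

    -- Finite ring extensions of a subfield

    record IsFiniteExtension (R : Pred Ord (lsuc 0ℓ ⊔ k)) : Set (lsuc 0ℓ ⊔ k) where
      field
        isSubring : IsSubring R
        extends   : K ⊆ R
        {degree}  : ℕ
        spanning  : Vec Ord degree
        spanned   : R ⊆ Span spanning

    -- As `x` is nonzero, vanishing low coefficients can be divided out. The first nonzero one, `c`,
    -- then equals `x` times a polynomial value, and dividing that value by `c` inverts `x`.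
    invert-root : ∀ {r m} {R : Pred Ord r} → IsSubring R → K ⊆ R →
                  ∀ {cs : Vec Ord m} {x} → All K cs → ¬ AllZero cs → x ∈ R → x ≉ 0# →
                  eval cs x ≈ 0# → ∃ λ y → y ∈ R × x ⊗ y ≈ 1#
    invert-root R-ring K⊆R [] cs≉0 x∈ x≉0 e = ⊥-elim (cs≉0 [])
    invert-root R-ring K⊆R {c ∷ cs} {x} (c∈ ∷ cs∈) cs≉0 x∈ x≉0 e with em {P = c ≈ 0#}
    ... | yes c≈0 = invert-root R-ring K⊆R cs∈ (λ z → cs≉0 (c≈0 ∷ z)) x∈ x≉0
      (decidable-stable em λ u≉0 → ⊗-nonzero x≉0 u≉0
        (≈-trans (≈-sym (≈-trans (⊕-cong c≈0 ≈-refl) (⊕-identityˡ _))) e))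
    ... | no c≉0 =
      let i , i∈ , h = inverses c∈ c≉0 in
      eval cs x ⊗ i ,
      IsSubring.⊗-closed R-ring (PolyFun.eval∈ R-ring (All.map K⊆R cs∈) x∈) (K⊆R i∈) ,
      (begin
        x ⊗ (eval cs x ⊗ i)  ≈⟨ ⊗-assoc x (eval cs x) i ⟨
        (x ⊗ eval cs x) ⊗ i  ≈⟨ ⊗-cong (⊕≈0⇒≈ e) ≈-refl ⟨
        c ⊗ i                ≈⟨ h ⟩
        1#                   ∎)

    module FiniteExtension {R : Pred Ord (lsuc 0ℓ ⊔ k)} (R-finite : IsFiniteExtension R) where
      open IsFiniteExtension R-finite
      open PolyFun isSubring

      -- The `suc degree` powers of `x` all lie in the span of `degree` vectors, so they are
      -- dependent.
      relation : ∀ {x} → x ∈ R →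
                 ∃ λ (cs : Vec Ord (suc degree)) → All K cs × ¬ AllZero cs × eval cs x ≈ 0#
      relation {x} x∈ =
        let cs , cs∈ , cs≉0 , e =
              dependent spanning (All.map spanned (powers∈ isSubring x∈ (suc degree)))
        in cs , cs∈ , cs≉0 , ≈-trans (≈-sym (dot-powers cs x)) e

      algebraic : R ⊆ AlgebraicOver K
      algebraic {x} x∈ with relation x∈
      ... | cs , cs∈ , cs≉0 , e with trim cs∈
      ...   | inj₁ z = ⊥-elim (cs≉0 z)
      ...   | inj₂ (d , _ , p , h) = d , p , ≈-trans (h x) e

      inverse : ∀ {x} → x ∈ R → x ≉ 0# → ∃ λ y → y ∈ R × x ⊗ y ≈ 1#
      inverse x∈ x≉0 =
        let cs , cs∈ , cs≉0 , e = relation x∈ in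
        invert-root isSubring extends cs∈ cs≉0 x∈ x≉0 e

      module _ {d x} (p : Polynomial R (suc d)) (root : IsRoot p x) where
        open Polynomial p

        -- Since `p` has degree `suc d`, the powers below that degree already generate the ring
        -- obtained by adjoining `x`.
        R[x] : Pred Ord (lsuc 0ℓ ⊔ k)
        R[x] = Values R x (suc d)

        R[x]-resp : R[x] Respects _≈_
        R[x]-resp e (cs , cs∈ , h) = cs , cs∈ , ≈-trans h e

        R[x]-⊕ : ∀ {y z} → y ∈ R[x] → z ∈ R[x] → y ⊕ z ∈ R[x]
        R[x]-⊕ (_ , cs∈ , e) (_ , ds∈ , h) =
          R[x]-resp (⊕-cong e h) (value x (add (polyFun cs∈) (polyFun ds∈)))

        R[x]-scale : ∀ {a y} → a ∈ R → y ∈ R[x] → a ⊗ y ∈ R[x]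
        R[x]-scale a∈ (_ , cs∈ , e) =
          R[x]-resp (⊗-cong ≈-refl e) (value x (scale a∈ (polyFun cs∈)))

        zeroPolyFun : ∀ k → IsPolyFun R k (λ _ → 0#)
        zeroPolyFun zero = [] , [] , λ _ → ≈-refl
        zeroPolyFun (suc k) = weaken (zeroPolyFun k)

        R⊆R[x] : R ⊆ R[x]
        R⊆R[x] {r} r∈ = R[x]-resp
          (solve 2 (λ r x → r :+ x :* con false := r) ≈-refl r x)
          (value x (cons r∈ (zeroPolyFun d)))

        -- Finiteness makes the leading coefficient of `p` invertible in `R`, so the equation for
        -- `x` can be solved for its top power.
        x^∈R[x] : x ^ suc d ∈ R[x]
        x^∈R[x] =
          let i , i∈ , h = inverse (last∈ coeffs∈) leading≉0
              ds , ds∈ , e = split-last coeffs∈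
              l = last coeffs
          in R[x]-resp (begin
            i ⊗ eval ds x          ≈⟨ ⊗-cong ≈-refl (⊕≈0⇒≈ (≈-trans (≈-sym (e x)) root)) ⟩
            i ⊗ (l ⊗ x ^ suc d)    ≈⟨ solve 3 (λ i l y → i :* (l :* y) := (l :* i) :* y)
                                        ≈-refl i l (x ^ suc d) ⟩
            (l ⊗ i) ⊗ x ^ suc d    ≈⟨ ⊗-cong h ≈-refl ⟩
            1# ⊗ x ^ suc d         ≈⟨ ⊗-identityˡ _ ⟩
            x ^ suc d              ∎) (R[x]-scale i∈ (ds , ds∈ , ≈-refl))

        -- Multiplication by `x` lengthens the coefficient vector by one; the overflowing term is an
        -- `R`-multiple of `x ^ suc d`.
        R[x]-shift : ∀ {y} → y ∈ R[x] → x ⊗ y ∈ R[x]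
        R[x]-shift (cs , cs∈ , e) =
          let es , es∈ , h = shift (polyFun cs∈)
              ds , ds∈ , f = split-last es∈
          in R[x]-resp (≈-trans (≈-sym (f x)) (≈-trans (h x) (⊗-cong ≈-refl e)))
               (R[x]-⊕ (ds , ds∈ , ≈-refl) (R[x]-scale (last∈ es∈) x^∈R[x]))

        R[x]-⊗-eval : ∀ {m} {cs : Vec Ord m} {y} → All R cs → y ∈ R[x] → eval cs x ⊗ y ∈ R[x]
        R[x]-⊗-eval {y = y} [] y∈ = R[x]-resp (≈-sym (⊗-zeroˡ y)) (R⊆R[x] (IsSubring.0∈ isSubring))
        R[x]-⊗-eval {cs = c ∷ cs} {y} (c∈ ∷ cs∈) y∈ = R[x]-resp
          (solve 4 (λ c x u y → c :* y :+ x :* (u :* y) := (c :+ x :* u) :* y)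
            ≈-refl c x (eval cs x) y)
          (R[x]-⊕ (R[x]-scale c∈ y∈) (R[x]-shift (R[x]-⊗-eval cs∈ y∈)))

        R[x]-isSubring : IsSubring R[x]
        R[x]-isSubring = record
          { respects = R[x]-resp
          ; 0∈ = R⊆R[x] (IsSubring.0∈ isSubring)
          ; 1∈ = R⊆R[x] (IsSubring.1∈ isSubring)
          ; ⊕-closed = R[x]-⊕
          ; ⊗-closed = λ (_ , cs∈ , e) z∈ → R[x]-resp (⊗-cong e ≈-refl) (R[x]-⊗-eval cs∈ z∈)
          }

        -- Obtained as `x ⊗ 1#`, because for `d = 0` the vector has no slot for the first power of
        -- `x`.
        x∈R[x] : x ∈ R[x]
        x∈R[x] = R[x]-resp (⊗-identityʳ x) (R[x]-shift (IsSubring.1∈ R[x]-isSubring))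

        -- As in the tower law, the generators of `R` times the powers of `x` span over `K`.
        Values-spanned : ∀ k → ∃ λ m → ∃ λ (ws : Vec Ord m) → Values R x k ⊆ Span ws
        Values-spanned zero = 0 , [] , λ { ([] , _ , e) → [] , [] , ≈-sym e }
        Values-spanned (suc k) with Values-spanned k
        ... | _ , ws , f = _ , spanning ++ map (x ⊗_) ws , λ { {y} (r ∷ cs , r∈ ∷ cs∈ , e) →
          let as , as∈ , h = spanned r∈
              bs , bs∈ , h′ = f (cs , cs∈ , ≈-refl)
          in as ++ bs , ++⁺ as∈ bs∈ , (begin
            y                                           ≈⟨ e ⟨
            r ⊕ x ⊗ eval cs x                           ≈⟨ ⊕-cong h (⊗-cong ≈-refl h′) ⟩
            dot as spanning ⊕ x ⊗ dot bs ws             ≈⟨ ⊕-cong ≈-refl (dot-scaleʳ x bs ws) ⟨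
            dot as spanning ⊕ dot bs (map (x ⊗_) ws)    ≈⟨ dot-++ as spanning bs _ ⟨
            dot (as ++ bs) (spanning ++ map (x ⊗_) ws)  ∎) }

        R[x]-isFinite : IsFiniteExtension R[x]
        R[x]-isFinite = record
          { isSubring = R[x]-isSubring
          ; extends = R⊆R[x] ∘ extends
          ; spanning = proj₁ (proj₂ (Values-spanned (suc d)))
          ; spanned = proj₂ (proj₂ (Values-spanned (suc d)))
          }

      adjoin : ∀ {x} → x ∈ AlgebraicOver R → ∃ λ R′ → IsFiniteExtension R′ × R ⊆ R′ × x ∈ R′
      adjoin {x} (zero , record { coeffs = c ∷ [] ; leading≉0 = c≉0 } , e) =
        ⊥-elim (constant≉0 x c≉0 e)
      adjoin (suc d , p , e) = R[x] p e , R[x]-isFinite p e , R⊆R[x] p e , x∈R[x] p e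

    -- `Lift` puts `K` at the universe level at which `adjoin` can be iterated.
    trivialExtension : IsFiniteExtension (Lift (lsuc 0ℓ) ∘ K)
    trivialExtension = record
      { isSubring = record
        { respects = λ e (lift x∈) → lift (IsSubfield.respects K-field e x∈)
        ; 0∈ = lift 0∈
        ; 1∈ = lift 1∈
        ; ⊕-closed = λ (lift x∈) (lift y∈) → lift (⊕-closed x∈ y∈)
        ; ⊗-closed = λ (lift x∈) (lift y∈) → lift (⊗-closed x∈ y∈)
        }
      ; extends = lift
      ; spanning = 1# ∷ []
      ; spanned = λ {x} (lift x∈) → x ∷ [] , x∈ ∷ [] ,
          solve 1 (λ x → x := x :* con true :+ con false) ≈-refl x
      }

    -- Closure properties of algebraic elements

    adjoinAll : ∀ {m} {xs : Vec Ord m} → All (AlgebraicOver K) xs →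
                ∃ λ R → IsFiniteExtension R × All R xs
    adjoinAll [] = _ , trivialExtension , []
    adjoinAll ((d , p , e) ∷ xs-alg) with adjoinAll xs-alg
    ... | R , R-finite , xs∈
      with FiniteExtension.adjoin R-finite
             (d , polynomial-⊆ p (All.map (IsFiniteExtension.extends R-finite) (Polynomial.coeffs∈ p)) , e)
    ...   | R′ , R′-finite , R⊆R′ , x∈ = R′ , R′-finite , x∈ ∷ All.map R⊆R′ xs∈

    algebraic-⊇ : K ⊆ AlgebraicOver K
    algebraic-⊇ x∈ = FiniteExtension.algebraic trivialExtension (lift x∈)

    algebraic-resp : AlgebraicOver K Respects _≈_
    algebraic-resp x≈y (d , p , e) =
      d , p , ≈-trans (≈-sym (eval-congʳ (Polynomial.coeffs p) x≈y)) e

    -- Two algebraic elements lie in a common finite extension, which contains their sum and product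
    -- and consists of algebraic elements.
    algebraic-isSubring : IsSubring (AlgebraicOver K)
    algebraic-isSubring = record
      { respects = algebraic-resp
      ; 0∈ = algebraic-⊇ 0∈
      ; 1∈ = algebraic-⊇ 1∈
      ; ⊕-closed = λ x-alg y-alg → closed (λ { R-ring (x∈ ∷ y∈ ∷ []) →
          IsSubring.⊕-closed R-ring x∈ y∈ }) (x-alg ∷ y-alg ∷ [])
      ; ⊗-closed = λ x-alg y-alg → closed (λ { R-ring (x∈ ∷ y∈ ∷ []) →
          IsSubring.⊗-closed R-ring x∈ y∈ }) (x-alg ∷ y-alg ∷ [])
      }
      where
      closed : ∀ {m} {xs : Vec Ord m} {y} →
               (∀ {R : Pred Ord (lsuc 0ℓ ⊔ k)} → IsSubring R → All R xs → y ∈ R) →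
               All (AlgebraicOver K) xs → y ∈ AlgebraicOver K
      closed f xs-alg =
        let R , R-finite , xs∈ = adjoinAll xs-alg in
        FiniteExtension.algebraic R-finite (f (IsFiniteExtension.isSubring R-finite) xs∈)

    -- The finitely many coefficients lie in one finite extension of `K`; adjoining the root to it
    -- gives another.
    algebraic-trans : AlgebraicOver (AlgebraicOver K) ⊆ AlgebraicOver K
    algebraic-trans (d , p , e) =
      let R , R-finite , coeffs∈ = adjoinAll (Polynomial.coeffs∈ p)
          R′ , R′-finite , _ , x∈ = FiniteExtension.adjoin R-finite (d , polynomial-⊆ p coeffs∈ , e)
      in FiniteExtension.algebraic R′-finite x∈

  -- A bound on the algebraic ordinals

  below-vec : ∀ {u m} {cs : Vec Ord m} → All (↓ u) cs →
              ∃ λ (is : Vec (Below u) m) → Pointwise _≈_ cs (map (elem u) is)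
  below-vec [] = [] , []
  below-vec {u} (c< ∷ cs<) =
    let i , e = below-complete u c<
        is , h = below-vec cs<
    in i ∷ is , e ∷ h

  -- Up to `_≈_`, the polynomials over `↓ u` are indexed by a small type through `Below u`, so the
  -- individual root bounds have a supremum.
  algebraic-bounded : ∀ u → ∃ λ β → ∀ x → x ∈ AlgebraicOver (↓ u) → x < β
  algebraic-bounded u = sup (Σ ℕ λ d → Vec (Below u) (suc d)) bound ,
    λ { x (d , p , e) →
      let is , h = below-vec {u} (Polynomial.coeffs∈ p)
          cs = map (elem u) is
      in (d , is) , bound-≥ x is
           (Polynomial.leading≉0 p ∘ ≈-trans (last-cong h))
           (≈-trans (≈-sym (eval-cong h ≈-refl)) e) }
    where
    bound : (Σ ℕ λ d → Vec (Below u) (suc d)) → Ord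
    bound (d , is) with em {P = last (map (elem u) is) ≈ 0#}
    -- Index vectors whose top entry is zero represent no polynomial of that degree; `0#` is a
    -- default.
    ... | yes _ = 0#
    ... | no l≉0 = proj₁ (rootBound (map (elem u) is) l≉0)

    bound-≥ : ∀ {d} x (is : Vec (Below u) (suc d)) → last (map (elem u) is) ≉ 0# →
              eval (map (elem u) is) x ≈ 0# → x ≤ bound (d , is)
    bound-≥ x is l≉0 e with em {P = last (map (elem u) is) ≈ 0#}
    ... | yes l≈0 = ⊥-elim (l≉0 l≈0)
    ... | no l≉0′ = proj₂ (rootBound (map (elem u) is) l≉0′) x e

  -- The least ordinal outside a subring

  module LeastOutside {ℓ} {P : Pred Ord ℓ} (P-ring : IsSubring P)
                      {Δ} (Δ-least : IsLeast (λ γ → ¬ (γ ∈ P)) Δ) where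
    open IsSubring P-ring

    Δ∉P : ¬ (Δ ∈ P)
    Δ∉P = proj₁ Δ-least

    ↓Δ⊆P : ↓ Δ ⊆ P
    ↓Δ⊆P {γ} γ<Δ = decidable-stable em λ γ∉P →
      <-irrefl {γ} (<-≤-trans {γ} {Δ} {γ} γ<Δ (proj₂ Δ-least γ γ∉P))

    ≉Δ : ∀ {γ} → γ ∈ P → Δ ≉ γ
    ≉Δ γ∈P e = Δ∉P (respects (≈-sym e) γ∈P)

    -- Otherwise `Δ ≤ γ < u` would put `Δ` into `P`.
    ↓⊆↓Δ : ∀ {u} → ↓ u ⊆ P → ↓ u ⊆ ↓ Δ
    ↓⊆↓Δ {u} u⊆P {γ} γ<u = decidable-stable em λ γ≮Δ →
      Δ∉P (u⊆P (≤-<-trans {Δ} {γ} {u} (≮⇒≥ γ Δ γ≮Δ) γ<u))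

    transcendental : ∀ n → (∀ d → 1 ℕ.≤ d → d ℕ.≤ n → (p : Polynomial (↓ Δ) d) →
                            ∀ x → IsRoot p x → x ∈ P) → IsNTranscendental n Δ
    transcendental n roots∈ = record
      -- An ordinal at most `1#` is `0#` or `1#`, and both lie in the ring.
      { 1<Δ = decidable-stable em λ 1≮Δ →
          Δ∉P (≤1⇒∈ (≮⇒≥ 1# Δ 1≮Δ))
      ; Δ≉⊕ = λ l m → ≉Δ (⊕-closed (↓Δ⊆P l) (↓Δ⊆P m))
      ; Δ≉⊗ = λ l m → ≉Δ (⊗-closed (↓Δ⊆P l) (↓Δ⊆P m))
      ; ¬root = λ d 1≤d d≤n p e → Δ∉P (roots∈ d 1≤d d≤n p Δ e)
      }
      where
      ≤1⇒∈ : ∀ {γ} → γ ≤ 1# → γ ∈ P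
      ≤1⇒∈ {γ} γ≤1 with em {P = γ ≈ 1#}
      ... | yes e = respects (≈-sym e) 1∈
      ... | no γ≉1 = let _ , γ≤0 = ≤∧≉⇒< γ 1# γ≤1 (γ≉1 ∘ ≈-sym) in
        respects (≈-sym (antisym γ≤0 (0≤ γ))) 0∈

  -- The algebraic closure of a field ordinal

  module AlgebraicClosure {u} (u-field : IsFieldOrdinal u) where

    -- The strict bound `β` is not below itself, hence not algebraic, so there is an ordinal to
    -- minimise over.
    ū-least : ∃ (IsLeast λ γ → ¬ (γ ∈ AlgebraicOver (↓ u)))
    ū-least = least _ (let β , <β = algebraic-bounded u in β , <-irrefl {β} ∘ <β β)

    ū : Ord
    ū = proj₁ ū-least

    open LeastOutside (algebraic-isSubring u-field) (proj₂ ū-least)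

    ū-transcendental : ∀ n → IsNTranscendental n ū
    ū-transcendental n = transcendental n λ d _ _ p x e →
      algebraic-trans u-field
        (d , polynomial-⊆ p (All.map (λ {γ} → ↓Δ⊆P {γ}) (Polynomial.coeffs∈ p)) , e)

    u⊆ū : ↓ u ⊆ ↓ ū
    u⊆ū {γ} = ↓⊆↓Δ {u} (algebraic-⊇ u-field) {γ}

    ū-isNClosed : ∀ n → IsNClosed n (↓ ū)
    ū-isNClosed n = ↓-isNClosed (ū-transcendental n)

    ū-isSubfield : IsSubfield (↓ ū)
    ū-isSubfield = ↓-isSubfield (ū-transcendental 1) ℕₚ.≤-refl

    ū⊆algebraic : ↓ ū ⊆ AlgebraicOver (↓ u)
    ū⊆algebraic {γ} = ↓Δ⊆P {γ}

    -- `↓ ū` is `d`-closed for the degree `d` of any polynomial over `↓ u`, so it contains all roots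
    -- of that polynomial.
    algebraic⊆ū : AlgebraicOver (↓ u) ⊆ ↓ ū
    algebraic⊆ū {x} (d , p , e) = nClosed⇒roots∈ (subfield⇒subring ū-isSubfield) (ū-isNClosed d)
      d ℕₚ.≤-refl (polynomial-⊆ p (All.map (λ {γ} → u⊆ū {γ}) (Polynomial.coeffs∈ p))) x e

    -- Inverses and roots are found in `↓ ū`, which has the same elements.
    isAlgebraicClosure : IsAlgebraicClosure (↓ u) (AlgebraicOver (↓ u))
    isAlgebraicClosure = record
      { isSubfield = record
        { IsSubring (algebraic-isSubring u-field)
        ; negatives = λ {α} α∈ → α , α∈ , ⊕-self α
        ; inverses = λ {α} α∈ α≉0 →
            let β , β∈ , e = IsSubfield.inverses ū-isSubfield {α} (algebraic⊆ū α∈) α≉0 in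
            β , ū⊆algebraic {β} β∈ , e
        }
      ; extends = algebraic-⊇ u-field
      ; algebraic = id
      ; algebraicallyClosed = λ d 1≤d p →
          let x , x∈ , e = ū-isNClosed d d 1≤d ℕₚ.≤-refl
                (polynomial-⊆ p (All.map algebraic⊆ū (Polynomial.coeffs∈ p)))
          in x , ū⊆algebraic {x} x∈ , e
      }

  -- The n-closure of a field ordinal

  nClosure-isOrdinal : ∀ {u} → IsFieldOrdinal u → ∀ n → 1 ℕ.≤ n → IsOrdinal (nClosure n u)
  nClosure-isOrdinal {u} u-field n 1≤n = w , C⊆w , λ {γ} → ↓Δ⊆P {γ}
    where
    open AlgebraicClosure u-field

    C : Pred Ord (lsuc 0ℓ)
    C = nClosure n u

    C⊆ū : C ⊆ ↓ ū
    -- `↓ ū` is one of the fields being intersected.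
    C⊆ū x∈ = x∈ (↓ ū) ū-isSubfield (ū-isNClosed n) (λ {γ} → u⊆ū {γ}) (λ {γ} → ū⊆algebraic {γ})

    u⊆C : ↓ u ⊆ C
    u⊆C {γ} γ<u F _ _ u⊆F _ = u⊆F {γ} γ<u

    C-isSubring : IsSubring C
    C-isSubring = record
      { respects = λ e x∈ F F-field c u⊆F F⊆ →
          IsSubfield.respects F-field e (x∈ F F-field c u⊆F F⊆)
      ; 0∈ = λ F F-field _ _ _ → IsSubfield.0∈ F-field
      ; 1∈ = λ F F-field _ _ _ → IsSubfield.1∈ F-field
      ; ⊕-closed = λ x∈ y∈ F F-field c u⊆F F⊆ →
          IsSubfield.⊕-closed F-field (x∈ F F-field c u⊆F F⊆) (y∈ F F-field c u⊆F F⊆)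
      ; ⊗-closed = λ x∈ y∈ F F-field c u⊆F F⊆ →
          IsSubfield.⊗-closed F-field (x∈ F F-field c u⊆F F⊆) (y∈ F F-field c u⊆F F⊆)
      }

    w-least : ∃ (IsLeast λ γ → ¬ (γ ∈ C))
    -- `C` lies inside `↓ ū`, so `ū` is an ordinal outside `C`.
    w-least = least _ (ū , <-irrefl {ū} ∘ C⊆ū)

    w : Ord
    w = proj₁ w-least

    open LeastOutside C-isSubring (proj₂ w-least)

    w-transcendental : IsNTranscendental n w
    -- Membership in `C` is checked in each intersected field `F`: the coefficients are below `w`,
    -- hence in `F`, and `F` contains all roots of degree at most `n`.
    w-transcendental = transcendental n λ d _ d≤n p x e F F-field F-closed u⊆F F⊆ →
      nClosed⇒roots∈ (subfield⇒subring F-field) F-closed d d≤n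
        (polynomial-⊆ p (All.map
          (λ {γ} γ<w → ↓Δ⊆P {γ} γ<w F F-field F-closed u⊆F F⊆) (Polynomial.coeffs∈ p))) x e

    C⊆w : C ⊆ ↓ w
    -- `↓ w` is itself one of the intersected fields; its elements are algebraic because it lies
    -- inside `C`, which lies inside `↓ ū`.
    C⊆w x∈ = x∈ (↓ w) (↓-isSubfield w-transcendental 1≤n) (↓-isNClosed w-transcendental)
      (λ {γ} → ↓⊆↓Δ {u} (λ {γ} → u⊆C {γ}) {γ})
      (λ {γ} γ<w → ū⊆algebraic {γ} (C⊆ū (↓Δ⊆P {γ} γ<w)))

proposition3p2 : (em : ∀ {ℓ} → ExcludedMiddle ℓ) → let open Nim em in
    (u : Ord) → IsFieldOrdinal u → (n : ℕ) → 1 ℕ.≤ n →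
    IsNClosure n (↓ u) (nClosure n u) × IsOrdinal (nClosure n u)
proposition3p2 em u u-field n 1≤n =
  (AlgebraicOver (↓ u) , AlgebraicClosure.isAlgebraicClosure em u-field , id , id) ,
  nClosure-isOrdinal em u-field n 1≤n
  where open Nim em
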